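{- The problem $\mathrm{PartSynth}(\mathrm{FO}^2[\sim,+1])$ is undecidable; that is, there is no algorithm which, given a finite alphabet $A=A_S\uplus A_E$ of actions and a sentence $\varphi\in\mathrm{FO}^2[\sim,+1]$ over $A$, decides whether there exist finite disjoint sets of processes $\mathbb{P}_S$ and $\mathbb{P}_E$ (with no shared processes) such that System has a winning strategy for $\varphi$.
   Context: **Data words.** $A$ is a finite alphabet of actions, partitioned into System actions $A_S$ and Environment actions $A_E$. Processes are partitioned between the players: $\mathbb{P}_S$ (System processes) and $\mathbb{P}_E$ (Environment processes) are disjoint finite sets, and there is no shared process. Let $\Sigma_S := A_S\times\mathbb{P}_S$, $\Sigma_E := A_E\times\mathbb{P}_E$, $\Sigma:=\Sigma_S\cup\Sigma_E$. A data word is a finite or infinite sequence $w=(a_0,p_0)(a_1,p_1)\cdots$ over $\Sigma$; each pair $(a_i,p_i)$ in the sequence is called a position. **Logic.** Formulas of $\mathrm{FO}^2[\sim,+1]$ are first-order formulas (connectives $\neg,\land,\lor,\exists,\forall$) using only two (reusable) variables $x,y$, built from the atoms $a(x)$ for $a\in A$, $x=y$, $x=y+1$, $x\sim y$, $\mathbb{P}_S(x)$, $\mathbb{P}_E(x)$ (and $\mathbb{P}_{SE}(x)$, for shared processes, which is interpreted as the empty set here), up to renaming of the two variables; the order $<$ is not available. A data word is represented as a structure whose domain has one element for each position and one element for each process in $\mathbb{P}_S\cup\mathbb{P}_E$ (including processes on which no action is played). $\mathbb{P}_S$ (resp. $\mathbb{P}_E$) is interpreted as the set of process elements of System (resp.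 Environment); $a$ is interpreted as the set of positions whose action is $a$; $+1$ is the successor relation of the linear order on positions ($x=y+1$ holds iff $x$ is the position immediately following position $y$); $\sim$ is the equivalence relation such that two positions $(a_i,p_i)$, $(a_j,p_j)$ are related iff $p_i=p_j$, and each process element $p$ is related to all positions of the form $(a,p)$. **Strategies.** A strategy for System is a function $\mathcal{S}:\Sigma^*\to\Sigma_S\cup\{\varepsilon\}$. An execution (data word) $w=\sigma_0\sigma_1\cdots$ is $\mathcal{S}$-compatible if (i) for all $0\le i<|w|$, $\sigma_i\in\Sigma_S$ implies $\sigma_i=\mathcal{S}(\sigma_0\cdots\sigma_{i-1})$, and (ii) if $w$ is finite then $\mathcal{S}(w)=\varepsilon$. It is fair for $\mathcal{S}$ if, whenever there are infinitely many $i$ with $\mathcal{S}(\sigma_0\cdots\sigma_{i-1})\neq\varepsilon$, there are infinitely many positions of $w$ in $\Sigma_S$. $\mathcal{S}$ is winning for $\varphi$ if all executions that are $\mathcal{S}$-compatible and fair for $\mathcal{S}$ satisfy $\varphi$. **Problem.** For a logic $\mathcal{L}$, $\mathrm{PartSynth}(\mathcal{L})$ is the problem: given $A=A_S\uplus A_E$ and a sentence $\varphi\in\mathcal{L}$, decide whether System has a winning strategy for $\varphi$ for some arbitrary finite sets $\mathbb{P}_S$ and $\mathbb{P}_E$ (no shared processes). -}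

module Defs where

open import Data.Bool using (Bool; true; false)
open import Data.Empty using (⊥)
open import Data.Fin using (Fin; zero; toℕ)
open import Data.List using (List; length; lookup; take; applyUpTo)
open import Data.Maybe using (Maybe; just; nothing)
open import Data.Nat using (ℕ; zero; suc; pred; _+_; _≤_)
open import Data.Product using (Σ; ∃-syntax; _×_; _,_; proj₁; proj₂)
open import Data.Sum using (_⊎_; inj₁; inj₂)
open import Data.Unit using (⊤; tt)
open import Data.Vec as Vec using (Vec; _∷_; updateAt; replicate)
open import Relation.Binary.PropositionalEquality using (_≡_; _≢_)
open import Relation.Nullary using (¬_; Reflects)

record Alphabet : Set where
  field
    ∣A-S∣ ∣A-E∣ : ℕ

  A-S A-E A : Set
  A-S = Fin ∣A-S∣
  A-E = Fin ∣A-E∣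
  A   = A-S ⊎ A-E

record Processes : Set where
  field
    ∣ℙ-S∣ ∣ℙ-E∣ : ℕ

  ℙ-S ℙ-E ℙ : Set
  ℙ-S = Fin ∣ℙ-S∣
  ℙ-E = Fin ∣ℙ-E∣
  ℙ   = ℙ-S ⊎ ℙ-E

-- The Booleans bx and by say whether the variables x and y are in scope.

data Var : (bx by : Bool) → Set where
  x : ∀ {by} → Var true by
  y : ∀ {bx} → Var bx true

data FO² (𝔸 : Alphabet) (bx by : Bool) : Set where
  act         : Alphabet.A 𝔸 → Var bx by → FO² 𝔸 bx by
  _≐_         : Var bx by → Var bx by → FO² 𝔸 bx by
  _≐_+1       : Var bx by → Var bx by → FO² 𝔸 bx by
  _∼_         : Var bx by → Var bx by → FO² 𝔸 bx by
  isS isE isSE : Var bx by → FO² 𝔸 bx by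
  neg         : FO² 𝔸 bx by → FO² 𝔸 bx by
  _and_ _or_  : FO² 𝔸 bx by → FO² 𝔸 bx by → FO² 𝔸 bx by
  existsx allx : FO² 𝔸 true by → FO² 𝔸 bx by
  existsy ally : FO² 𝔸 bx true → FO² 𝔸 bx by

Sentence : Alphabet → Set
Sentence 𝔸 = FO² 𝔸 false false

module _ (𝔸 : Alphabet) (𝒫 : Processes) where
  open Alphabet 𝔸
  open Processes 𝒫

  Σ-S Σ-E Letter : Set
  Σ-S    = A-S × ℙ-S
  Σ-E    = A-E × ℙ-E
  Letter = Σ-S ⊎ Σ-E

  data DataWord : Set where
    finite   : List Letter → DataWord
    infinite : (ℕ → Letter) → DataWord

  Strategy : Set
  Strategy = List Letter → Maybe Σ-S

module _ {𝔸 : Alphabet} {𝒫 : Processes} where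
  open Alphabet 𝔸
  open Processes 𝒫

  action : Letter 𝔸 𝒫 → A
  action (inj₁ (a , _)) = inj₁ a
  action (inj₂ (a , _)) = inj₂ a

  process : Letter 𝔸 𝒫 → ℙ
  process (inj₁ (_ , p)) = inj₁ p
  process (inj₂ (_ , p)) = inj₂ p

  Position : DataWord 𝔸 𝒫 → Set
  Position (finite σs)  = Fin (length σs)
  Position (infinite _) = ℕ

  index : (w : DataWord 𝔸 𝒫) → Position w → ℕ
  index (finite _)   i = toℕ i
  index (infinite _) i = i

  letterAt : (w : DataWord 𝔸 𝒫) → Position w → Letter 𝔸 𝒫
  letterAt (finite σs)  i = lookup σs i
  letterAt (infinite σ) i = σ i

  -- σ₀ ⋯ σᵢ₋₁, in chronological order
  historyAt : (w : DataWord 𝔸 𝒫) → Position w → List (Letter 𝔸 𝒫)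
  historyAt (finite σs)  i = take (toℕ i) σs
  historyAt (infinite σ) i = applyUpTo σ i

  Dom : DataWord 𝔸 𝒫 → Set
  Dom w = Position w ⊎ ℙ

  module _ (w : DataWord 𝔸 𝒫) where

    processOf : Dom w → ℙ
    processOf (inj₁ i) = process (letterAt w i)
    processOf (inj₂ p) = p

    HasAction : A → Dom w → Set
    HasAction a (inj₁ i) = action (letterAt w i) ≡ a
    HasAction a (inj₂ _) = ⊥

    IsSuccessorOf : Dom w → Dom w → Set
    IsSuccessorOf (inj₁ i) (inj₁ j) = index w i ≡ suc (index w j)
    IsSuccessorOf _        _        = ⊥

    -- ℙ_S and ℙ_E contain process elements only, never positions.
    IsSystemProcess IsEnvironmentProcess : Dom w → Set
    IsSystemProcess      d = ∃[ p ] d ≡ inj₂ (inj₁ p)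
    IsEnvironmentProcess d = ∃[ p ] d ≡ inj₂ (inj₂ p)

    Value : Bool → Set
    Value true  = Dom w
    Value false = ⊤

    value : ∀ {bx by} → Var bx by → Value bx × Value by → Dom w
    value x (d , _) = d
    value y (_ , e) = e

    -- Satisfaction is classical, so disjunction and existential
    -- quantification are read through their de Morgan duals.  The atoms
    -- are decidable, hence ⟦ φ ⟧ is always ¬¬-stable.
    ⟦_⟧ : ∀ {bx by} → FO² 𝔸 bx by → Value bx × Value by → Set
    ⟦ act a u   ⟧ ρ = HasAction a (value u ρ)
    ⟦ u ≐ v     ⟧ ρ = value u ρ ≡ value v ρ
    ⟦ u ≐ v +1  ⟧ ρ = IsSuccessorOf (value u ρ) (value v ρ)
    ⟦ u ∼ v     ⟧ ρ = processOf (value u ρ) ≡ processOf (value v ρ)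
    ⟦ isS u     ⟧ ρ = IsSystemProcess (value u ρ)
    ⟦ isE u     ⟧ ρ = IsEnvironmentProcess (value u ρ)
    ⟦ isSE u    ⟧ ρ = ⊥  -- there are no shared processes
    ⟦ neg φ     ⟧ ρ = ¬ ⟦ φ ⟧ ρ
    ⟦ φ and ψ   ⟧ ρ = ⟦ φ ⟧ ρ × ⟦ ψ ⟧ ρ
    ⟦ φ or ψ    ⟧ ρ = ¬ (¬ ⟦ φ ⟧ ρ × ¬ ⟦ ψ ⟧ ρ)
    ⟦ existsx φ ⟧ ρ = ¬ (∀ d → ¬ ⟦ φ ⟧ (d , proj₂ ρ))
    ⟦ existsy φ ⟧ ρ = ¬ (∀ d → ¬ ⟦ φ ⟧ (proj₁ ρ , d))
    ⟦ allx φ    ⟧ ρ = ∀ d → ⟦ φ ⟧ (d , proj₂ ρ)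
    ⟦ ally φ    ⟧ ρ = ∀ d → ⟦ φ ⟧ (proj₁ ρ , d)

    -- P holds at infinitely many positions, again read classically: no
    -- bound n excludes P from n on.
    InfinitelyOften : (Position w → Set) → Set
    InfinitelyOften P = ∀ n → ¬ (∀ i → n ≤ index w i → ¬ P i)

  _⊨_ : DataWord 𝔸 𝒫 → Sentence 𝔸 → Set
  w ⊨ φ = ⟦_⟧ w φ (tt , tt)

  StopsAt : DataWord 𝔸 𝒫 → Strategy 𝔸 𝒫 → Set
  StopsAt (finite σs)  𝒮 = 𝒮 σs ≡ nothing
  StopsAt (infinite _) 𝒮 = ⊤

  Compatible : Strategy 𝔸 𝒫 → DataWord 𝔸 𝒫 → Set
  Compatible 𝒮 w =
    (∀ i σ → letterAt w i ≡ inj₁ σ → 𝒮 (historyAt w i) ≡ just σ)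
    × StopsAt w 𝒮

  Fair : Strategy 𝔸 𝒫 → DataWord 𝔸 𝒫 → Set
  Fair 𝒮 w =
    InfinitelyOften w (λ i → 𝒮 (historyAt w i) ≢ nothing) →
    InfinitelyOften w (λ i → ∃[ σ ] letterAt w i ≡ inj₁ σ)

  Winning : Strategy 𝔸 𝒫 → Sentence 𝔸 → Set
  Winning 𝒮 φ = ∀ w → Compatible 𝒮 w → Fair 𝒮 w → w ⊨ φ

Instance : Set
Instance = Σ Alphabet Sentence

PartSynth : Instance → Set
PartSynth (𝔸 , φ) =
  Σ Processes λ 𝒫 → Σ (Strategy 𝔸 𝒫) λ 𝒮 → Winning 𝒮 φ

-- Algorithms are Minsky register machines deciding sets of natural
-- numbers: `inc r l` increments r and goes to l; `dec r l l₀` decrements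
-- r and goes to l if r is positive, and goes to l₀ if r is zero;
-- `halt b` answers b.

data Instr (registers labels : ℕ) : Set where
  inc  : Fin registers → Fin labels → Instr registers labels
  dec  : Fin registers → (l l₀ : Fin labels) → Instr registers labels
  halt : Bool → Instr registers labels

-- Register zero holds the input and label zero is the entry point.
record Machine : Set where
  field
    r-1 l-1 : ℕ
    program : Vec (Instr (suc r-1) (suc l-1)) (suc l-1)

  Config : Set
  Config = Fin (suc l-1) × Vec ℕ (suc r-1)

  initial : ℕ → Config
  initial n = zero , n ∷ replicate r-1 0

  exec : Instr (suc r-1) (suc l-1) → Vec ℕ (suc r-1) → Config ⊎ Bool
  exec (inc r l)    v = inj₁ (l , updateAt v r suc)
  exec (dec r l l₀) v with Vec.lookup v r
  ... | zero  = inj₁ (l₀ , v)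
  ... | suc _ = inj₁ (l , updateAt v r pred)
  exec (halt b)     v = inj₂ b

  step : Config → Config ⊎ Bool
  step (l , v) = exec (Vec.lookup program l) v

module _ (M : Machine) where
  open Machine M

  -- the computation from configuration c ends with answer b
  data Answers (c : Config) (b : Bool) : Set where
    now   : step c ≡ inj₂ b → Answers c b
    later : ∀ {c′} → step c ≡ inj₁ c′ → Answers c′ b → Answers c b

-- Cantor's bijection ℕ × ℕ → ℕ
triangle : ℕ → ℕ
triangle zero    = zero
triangle (suc n) = suc n + triangle n

⟨_,_⟩ : ℕ → ℕ → ℕ
⟨ m , n ⟩ = triangle (m + n) + n

-- Scopes need not be encoded: they are determined by the quantifiers above.

codeVar : ∀ {bx by} → Var bx by → ℕ
codeVar x = 0
codeVar y = 1

codeFO² : ∀ {𝔸 bx by} → FO² 𝔸 bx by → ℕ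
codeFO² (act (inj₁ a) u) = ⟨ 0 , ⟨ toℕ a , codeVar u ⟩ ⟩
codeFO² (act (inj₂ a) u) = ⟨ 1 , ⟨ toℕ a , codeVar u ⟩ ⟩
codeFO² (u ≐ v)          = ⟨ 2 , ⟨ codeVar u , codeVar v ⟩ ⟩
codeFO² (u ≐ v +1)       = ⟨ 3 , ⟨ codeVar u , codeVar v ⟩ ⟩
codeFO² (u ∼ v)          = ⟨ 4 , ⟨ codeVar u , codeVar v ⟩ ⟩
codeFO² (isS u)          = ⟨ 5 , codeVar u ⟩
codeFO² (isE u)          = ⟨ 6 , codeVar u ⟩
codeFO² (isSE u)         = ⟨ 7 , codeVar u ⟩
codeFO² (neg φ)          = ⟨ 8 , codeFO² φ ⟩
codeFO² (φ and ψ)        = ⟨ 9 , ⟨ codeFO² φ , codeFO² ψ ⟩ ⟩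
codeFO² (φ or ψ)         = ⟨ 10 , ⟨ codeFO² φ , codeFO² ψ ⟩ ⟩
codeFO² (existsx φ)      = ⟨ 11 , codeFO² φ ⟩
codeFO² (existsy φ)      = ⟨ 12 , codeFO² φ ⟩
codeFO² (allx φ)         = ⟨ 13 , codeFO² φ ⟩
codeFO² (ally φ)         = ⟨ 14 , codeFO² φ ⟩

code : Instance → ℕ
code (𝔸 , φ) = ⟨ ∣A-S∣ , ⟨ ∣A-E∣ , codeFO² φ ⟩ ⟩
  where open Alphabet 𝔸

-- M halts on the code of every instance, with the correct answer.
_Decides_ : Machine → (Instance → Set) → Set
M Decides P =
  ∀ i → ∃[ b ] Answers M (Machine.initial M (code i)) b × Reflects (P i) b

{-# OPTIONS --safe #-}

-- System plays a run of a counter program, one letter per instruction.  The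
-- value of a register r is the number of processes that carry an increment of r
-- but no decrement of r.  Without an order, FO² cannot say that all increments
-- *before* a zero test are matched; but Environment may stop the play at any
-- time, since no letter of System may follow one of Environment, and so it is
-- enough to check a test while it is the last letter of System.  Hence System
-- wins iff the program has an accepting run: it picks a long enough ℙ_S, and
-- the formula demands a process in ℙ_E.
--
-- The input n of the program is half the number of initial load letters, fixed by
-- a chain of 2n nested successor steps.  The code of this chain is an n-fold
-- iteration of a fixed function, so a program can compute from n the code of
-- the instance with alphabet size n, game formula of code n and input n, run a
-- supposed decider M on it, and accept iff M answers no.  Taking for n the code
-- of the game formula of this very program makes M answer wrongly.
module Submission where

open import Defs
open import Data.Bool using (Bool; true; false)
open import Data.Empty using (⊥; ⊥-elim)
open import Data.Fin as Fin using (Fin; zero; suc; toℕ; fromℕ<; inject≤)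
open import Data.Fin.Properties as Fin
  using (+↔⊎; 0↔⊥; 1↔⊤; 2↔Bool; toℕ-fromℕ<; toℕ-inject≤; inject≤-injective)
open import Data.List as List
  using (List; []; _∷_; _∷ʳ_; _++_; length; take; reverse; applyUpTo; allFin; filter)
open import Data.List.Properties
  using (length-map; length-++; applyUpTo-∷ʳ; unfold-reverse; reverse-++; reverse-involutive;
         length-reverse; ∷-injectiveˡ)
open import Data.List.Membership.Propositional using (_∈_)
open import Data.List.Membership.Propositional.Properties
  using (∈-map⁺; ∈-allFin; ∈-filter⁺; ∈-filter⁻; ∈-∃++)
open import Data.List.Relation.Binary.Permutation.Propositional
  using (_↭_; ↭-sym; ↭-refl; ↭-reflexive; ↭-trans; ↭⇒↭ₛ)
open import Data.List.Relation.Binary.Permutation.Propositional.Properties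
  using (∈-resp-↭; ↭-length; shift)
import Data.List.Relation.Binary.Permutation.Setoid.Properties as Permutation
open import Data.List.Relation.Unary.All as All using (All; []; _∷_)
open import Data.List.Relation.Unary.AllPairs using ([]; _∷_)
open import Data.List.Relation.Unary.Any using (here; there)
open import Data.List.Relation.Unary.Unique.Propositional using (Unique)
open import Data.Maybe using (Maybe; just; nothing)
open import Data.Nat renaming (_≟_ to _≟ⁿ_)
open import Data.Nat.Properties hiding (_≟_)
open import Data.Product
open import Data.Product.Properties using (≡-dec)
open import Data.Sum using (_⊎_; inj₁; inj₂; [_,_]′)
open import Data.Sum.Function.Propositional using (_⊎-↔_)
open import Data.Sum.Properties using (inj₁-injective)
open import Data.Unit using (⊤; tt)
open import Data.Vec as Vec using (Vec; []; _∷_; updateAt; lookup)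
open import Data.Vec.Properties
  using (lookup-map; map-updateAt; map-replicate; lookup-replicate; lookup∘updateAt; lookup∘updateAt′)
open import Function using (_∘_; const; _↔_; Inverse)
open import Function.Construct.Composition using (_↔-∘_)
open import Function.Construct.Identity using (↔-id)
open import Function.Construct.Symmetry using (↔-sym)
open import Relation.Binary.PropositionalEquality
open import Relation.Nullary using (¬_; contradiction; Dec; yes; no; Reflects; ofʸ; ofⁿ)
open import Relation.Nullary.Decidable using (decidable-stable)

-- Counter programs

-- The program cannot mention its own code, but `game` depends on the program alone and n enters
-- only through `loadsᶠ`. So n may be fixed afterwards, and feeding the code in as input replaces a
-- recursion theorem. `padding` makes this code large enough to be an alphabet size, and passing to
-- the larger alphabet does not change it. Two letters per unit of input have two reasons. After two
-- successor steps the chain is back at the variable `x`, so that it nests in itself; and the input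
-- is wanted three times, so each letter loads one copy, while a third is counted off when the first
-- is consumed. A decider halts on the code of every instance, hence the program halts on the chosen
-- input, and its run is forced letter by letter. If the flag is up, the halting letter is blocked
-- and some length has no run at all. So it suffices to turn a winning strategy into runs of every
-- length, an accepting run being prolonged by repeated halting letters. Satisfaction is classical,
-- so these runs are found only up to double negation, which is enough for a contradiction.

data Prog (R : ℕ) : Set where
  skip : Prog R
  inc  : Fin R → Prog R
  _⨾_  : Prog R → Prog R → Prog R
  loop : Fin R → Prog R → Prog R
  ifz  : Fin R → Prog R → Prog R → Prog R

infixr 5 _⨾_

infix 4 _⊢_⇓_
infix 6 _⇓≡_

data _⊢_⇓_ {R : ℕ} : Prog R → Vec ℕ R → Vec ℕ R → Set where
  skip     : ∀ {v} → skip ⊢ v ⇓ v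
  inc      : ∀ {r v} → inc r ⊢ v ⇓ updateAt v r suc
  _⨾_      : ∀ {P Q u v w} → P ⊢ u ⇓ v → Q ⊢ v ⇓ w → P ⨾ Q ⊢ u ⇓ w
  loop-end : ∀ {r P v} → lookup v r ≡ 0 → loop r P ⊢ v ⇓ v
  loop-go  : ∀ {r P u v w n} → lookup u r ≡ suc n → P ⊢ updateAt u r pred ⇓ v →
             loop r P ⊢ v ⇓ w → loop r P ⊢ u ⇓ w
  ifz-zero : ∀ {r P Q u v} → lookup u r ≡ 0 → P ⊢ u ⇓ v → ifz r P Q ⊢ u ⇓ v
  ifz-suc  : ∀ {r P Q u v n} → lookup u r ≡ suc n → Q ⊢ updateAt u r pred ⇓ v →
             ifz r P Q ⊢ u ⇓ v

_⇓≡_ : ∀ {R} {P : Prog R} {u v w} → P ⊢ u ⇓ v → v ≡ w → P ⊢ u ⇓ w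
d ⇓≡ refl = d

-- Formula codes are huge: they are handled over an arbitrary pairing function,
-- so that type checking does not evaluate them.
module Nesting (_⊗_ : ℕ → ℕ → ℕ) where

  wrap : List ℕ → ℕ → ℕ
  wrap ks z = List.foldr _⊗_ z ks

  wraps : List ℕ → ℕ → ℕ → ℕ
  wraps ks zero    z = z
  wraps ks (suc n) z = wrap ks (wraps ks n z)

  -- Alphabet sizes n and 1, and the conjunction (tag 9) of a formula of code n
  -- with the chain for n.
  target : (x₀ : ℕ) (ks ls : List ℕ) → ℕ → ℕ
  target x₀ ks ls n = n ⊗ wrap (1 ∷ 9 ∷ []) (n ⊗ wrap ls (wraps ks n x₀))

-- Computing codes with counter programs

module _ {m : ℕ} where
  open Nesting ⟨_,_⟩

  Registers : ℕ
  Registers = 9 + suc m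

  -- N₁, N₂ and N₃ hold copies of the input; S, O and T are scratch registers of
  -- the pairing function, whose result is in B, the input register of the
  -- simulated machine; F flags a positive answer, G is set while the machine
  -- is running, and PC is its program counter.
  N₁ N₂ N₃ S O T F G PC B : Fin Registers
  N₁ = zero
  N₂ = suc zero
  N₃ = suc (suc zero)
  S  = suc (suc (suc zero))
  O  = suc (suc (suc (suc zero)))
  T  = suc (suc (suc (suc (suc zero))))
  F  = suc (suc (suc (suc (suc (suc zero)))))
  G  = suc (suc (suc (suc (suc (suc (suc zero))))))
  PC = suc (suc (suc (suc (suc (suc (suc (suc zero)))))))

  reg : Fin (suc m) → Fin Registers
  reg r = suc (suc (suc (suc (suc (suc (suc (suc (suc r))))))))
  B  = reg zero

  state : (n₁ n₂ n₃ s o t f g pc : ℕ) → Vec ℕ (suc m) → Vec ℕ Registers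
  state n₁ n₂ n₃ s o t f g pc v =
    n₁ ∷ n₂ ∷ n₃ ∷ s ∷ o ∷ t ∷ f ∷ g ∷ pc ∷ v

  incs : ℕ → Fin Registers → Prog Registers → Prog Registers
  incs zero    r P = P
  incs (suc k) r P = inc r ⨾ incs k r P

  move : Fin Registers → Fin Registers → Prog Registers
  move r r′ = loop r (inc r′)

  -- With a in `S` and b in `B`, the first loop leaves a + b in `S` and b in `O`. The second adds
  -- the triangular number s + (s - 1) + ... + 1 of s = a + b to `O`, each pass restoring from `T`
  -- what it has read off `S`. The last loop brings the result back to `B`.
  pair : Prog Registers
  pair = loop B (inc S ⨾ inc O)
       ⨾ loop S (inc O ⨾ loop S (inc O ⨾ inc T) ⨾ move T S)
       ⨾ move O B

  pairs : List ℕ → Prog Registers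
  pairs []       = skip
  pairs (k ∷ ks) = pairs ks ⨾ incs k S pair

  module _ {n₁ n₂ n₃ f g pc : ℕ} {v : Vec ℕ m} where

    private
      st : (s o t b : ℕ) → Vec ℕ Registers
      st s o t b = state n₁ n₂ n₃ s o t f g pc (b ∷ v)

    split-B : ∀ b {s o} → loop B (inc S ⨾ inc O) ⊢ st s o 0 b ⇓ st (b + s) (b + o) 0 0
    split-B zero = loop-end refl
    split-B (suc b) {s} {o} = loop-go refl (inc ⨾ inc)
      (split-B b ⇓≡ cong₂ (λ s o → st s o 0 0) (+-suc b s) (+-suc b o))

    split-S : ∀ s {o t} → loop S (inc O ⨾ inc T) ⊢ st s o t 0 ⇓ st 0 (s + o) (s + t) 0
    split-S zero = loop-end refl
    split-S (suc s) {o} {t} = loop-go refl (inc ⨾ inc)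
      (split-S s ⇓≡ cong₂ (λ o t → st 0 o t 0) (+-suc s o) (+-suc s t))

    move-T-S : ∀ t {s o} → move T S ⊢ st s o t 0 ⇓ st (t + s) o 0 0
    move-T-S zero = loop-end refl
    move-T-S (suc t) {s} {o} = loop-go refl inc
      (move-T-S t ⇓≡ cong (λ s → st s o 0 0) (+-suc t s))

    move-O-B : ∀ o {b} → move O B ⊢ st 0 o 0 b ⇓ st 0 0 0 (o + b)
    move-O-B zero = loop-end refl
    move-O-B (suc o) {b} = loop-go refl inc
      (move-O-B o ⇓≡ cong (st 0 0 0) (+-suc o b))

    add-triangle : ∀ s {o} →
      loop S (inc O ⨾ loop S (inc O ⨾ inc T) ⨾ move T S) ⊢ st s o 0 0 ⇓ st 0 (triangle s + o) 0 0
    add-triangle zero = loop-end refl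
    add-triangle (suc s) {o} = loop-go refl
      (inc ⨾ split-S s ⨾ (move-T-S (s + 0) ⇓≡ cong (λ s′ → st s′ (s + suc o) 0 0) eq₁))
      (add-triangle s ⇓≡ cong (λ o → st 0 o 0 0) eq₂)
      where
      eq₁ : s + 0 + 0 ≡ s
      eq₁ = trans (+-identityʳ (s + 0)) (+-identityʳ s)
      eq₂ : triangle s + (s + suc o) ≡ suc s + triangle s + o
      eq₂ rewrite +-suc s o | +-suc (triangle s) (s + o)
        = cong suc (trans (sym (+-assoc (triangle s) s o)) (cong (_+ o) (+-comm (triangle s) s)))

    pair-⇓ : ∀ {a b} → pair ⊢ st a 0 0 b ⇓ st 0 0 0 ⟨ a , b ⟩
    pair-⇓ {a} {b} = split-B b ⨾ add-triangle (b + a)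
      ⨾ (move-O-B (triangle (b + a) + (b + 0)) ⇓≡ cong (st 0 0 0) eq)
      where
      eq : triangle (b + a) + (b + 0) + 0 ≡ ⟨ a , b ⟩
      eq rewrite +-identityʳ (triangle (b + a) + (b + 0)) | +-identityʳ b | +-comm b a = refl

    incs-S : ∀ k {s o t b P w} → P ⊢ st (k + s) o t b ⇓ w → incs k S P ⊢ st s o t b ⇓ w
    incs-S zero d = d
    incs-S (suc k) {s} {o} {t} {b} {P} {w} d =
      inc ⨾ incs-S k (subst (λ s′ → P ⊢ st s′ o t b ⇓ w) (sym (+-suc k s)) d)

    incs-B : ∀ k {b P w} → P ⊢ st 0 0 0 (k + b) ⇓ w → incs k B P ⊢ st 0 0 0 b ⇓ w
    incs-B zero d = d
    incs-B (suc k) {b} {P} {w} d =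
      inc ⨾ incs-B k (subst (λ b′ → P ⊢ st 0 0 0 b′ ⇓ w) (sym (+-suc k b)) d)

    pairs-⇓ : ∀ ks {b} → pairs ks ⊢ st 0 0 0 b ⇓ st 0 0 0 (wrap ks b)
    pairs-⇓ []       = skip
    pairs-⇓ (k ∷ ks) {b} = pairs-⇓ ks ⨾ incs-S k
      (pair-⇓ ⇓≡ cong (λ k → st 0 0 0 ⟨ k , wrap ks b ⟩) (+-identityʳ k))

  module _ {n₁ n₂ n₃ f g pc : ℕ} {v : Vec ℕ (suc m)} where
    move-N₂-S : ∀ n {s} → move N₂ S ⊢ state n₁ n n₃ s 0 0 f g pc v ⇓ state n₁ 0 n₃ (n + s) 0 0 f g pc v
    move-N₂-S zero = loop-end refl
    move-N₂-S (suc n) {s} = loop-go refl inc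
      (move-N₂-S n ⇓≡ cong (λ s → state n₁ 0 n₃ s 0 0 f g pc v) (+-suc n s))

    move-N₃-S : ∀ n {s} → move N₃ S ⊢ state n₁ n₂ n s 0 0 f g pc v ⇓ state n₁ n₂ 0 (n + s) 0 0 f g pc v
    move-N₃-S zero = loop-end refl
    move-N₃-S (suc n) {s} = loop-go refl inc
      (move-N₃-S n ⇓≡ cong (λ s → state n₁ n₂ 0 s 0 0 f g pc v) (+-suc n s))

  module _ {n₂ f g pc : ℕ} {v : Vec ℕ m} where
    wraps-⇓ : ∀ ks n {n₃ b} →
      loop N₁ (pairs ks ⨾ inc N₃) ⊢ state n n₂ n₃ 0 0 0 f g pc (b ∷ v)
        ⇓ state 0 n₂ (n + n₃) 0 0 0 f g pc (wraps ks n b ∷ v)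
    wraps-⇓ ks zero = loop-end refl
    wraps-⇓ ks (suc n) {n₃} {b} = loop-go refl (pairs-⇓ ks ⨾ inc)
      (wraps-⇓ ks n ⇓≡ cong₂ (λ n₃ b → state 0 n₂ n₃ 0 0 0 f g pc (b ∷ v)) (+-suc n n₃) (wraps-wrap n b))
      where
      -- The loop adds its layers at the inside, `wraps` adds them at the outside; all layers being
      -- equal, the two agree.
      wraps-wrap : ∀ n z → wraps ks n (wrap ks z) ≡ wrap ks (wraps ks n z)
      wraps-wrap zero    z = refl
      wraps-wrap (suc n) z = cong (wrap ks) (wraps-wrap n z)

-- Simulating the register machine

module Simulation (M : Machine) where
  open Machine M
  open Nesting ⟨_,_⟩

  private
    P = Prog (Registers {r-1})

  -- When an instruction runs, `switch` has counted `PC` down to zero and the enclosing loop has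
  -- taken `G` from one to zero, so increments are enough to set both. A halting instruction leaves
  -- `G` at zero, which ends the loop.
  goto : Fin (suc l-1) → P
  goto l = incs (toℕ l) PC (inc G)

  instruction : Instr (suc r-1) (suc l-1) → P
  instruction (inc r l)    = inc (reg r) ⨾ goto l
  instruction (dec r l l₀) = ifz (reg r) (goto l₀) (goto l)
  instruction (halt true)  = inc F
  instruction (halt false) = skip

  switch : ∀ {k} → Vec P k → P
  switch []       = skip
  switch (Q ∷ Qs) = ifz PC Q (switch Qs)

  body : P
  body = switch (Vec.map instruction program)

  simulate : P
  simulate = inc G ⨾ loop G body

  private
    st : (f g pc : ℕ) → Vec ℕ (suc r-1) → Vec ℕ (Registers {r-1})
    st f g pc v = state 0 0 0 0 0 0 f g pc v

  goto-⇓ : ∀ l {v} → goto l ⊢ st 0 0 0 v ⇓ st 0 1 (toℕ l) v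
  goto-⇓ l {v} = go (toℕ l) ⇓≡ cong (λ pc → st 0 1 pc v) (+-identityʳ (toℕ l))
    where
    go : ∀ k {pc} → incs k PC (inc G) ⊢ st 0 0 pc v ⇓ st 0 1 (k + pc) v
    go zero = inc
    go (suc k) {pc} = inc ⨾ (go k ⇓≡ cong (λ pc → st 0 1 pc v) (+-suc k pc))

  switch-⇓ : ∀ {k} (Qs : Vec P k) l {v w} → lookup Qs l ⊢ st 0 0 0 v ⇓ w →
             switch Qs ⊢ st 0 0 (toℕ l) v ⇓ w
  switch-⇓ (Q ∷ Qs) zero    d = ifz-zero refl d
  switch-⇓ (Q ∷ Qs) (suc l) d = ifz-suc refl (switch-⇓ Qs l d)

  body-⇓ : ∀ l {v w} → instruction (lookup program l) ⊢ st 0 0 0 v ⇓ w →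
           body ⊢ st 0 0 (toℕ l) v ⇓ w
  body-⇓ l d = switch-⇓ (Vec.map instruction program) l
    (subst (λ Q → Q ⊢ _ ⇓ _) (sym (lookup-map l instruction program)) d)

  instruction-⇓ : ∀ i {v l v′} → exec i v ≡ inj₁ (l , v′) →
                  instruction i ⊢ st 0 0 0 v ⇓ st 0 1 (toℕ l) v′
  instruction-⇓ (inc r l) refl = inc ⨾ goto-⇓ l
  instruction-⇓ (dec r l l₀) {v} eq with lookup v r in eq-r
  instruction-⇓ (dec r l l₀) refl | zero  = ifz-zero eq-r (goto-⇓ l₀)
  instruction-⇓ (dec r l l₀) refl | suc _ = ifz-suc eq-r (goto-⇓ l)

  flag : Bool → ℕ
  flag true  = 1
  flag false = 0

  instruction-halt : ∀ i {v b} → exec i v ≡ inj₂ b →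
                     instruction i ⊢ st 0 0 0 v ⇓ st (flag b) 0 0 v
  instruction-halt (dec r l l₀) {v} eq with lookup v r
  instruction-halt (dec r l l₀) () | zero
  instruction-halt (dec r l l₀) () | suc _
  instruction-halt (halt true)  refl = inc
  instruction-halt (halt false) refl = skip

  loop-⇓ : ∀ {l v b} → Answers M (l , v) b →
           ∃[ w ] loop G body ⊢ st 0 1 (toℕ l) v ⇓ w × lookup w F ≡ flag b
  loop-⇓ {l} (now eq) =
    _ , loop-go refl (body-⇓ l (instruction-halt (lookup program l) eq)) (loop-end refl) , refl
  loop-⇓ {l} (later eq d) with loop-⇓ d
  ... | w , e , eq-F = w , loop-go refl (body-⇓ l (instruction-⇓ (lookup program l) eq)) e , eq-F

  module _ (x₀ : ℕ) (ks ls : List ℕ) where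

    -- The code is assembled in `B` from the inside out: the innermost formula, n layers of the
    -- chain, the outer quantifier and disjunction, the game on its left from `N₂`, the conjunction
    -- tag 9, the size 1 of the Environment alphabet, and the size of the System alphabet from `N₃`.
    main : P
    main = incs x₀ B (loop N₁ (pairs ks ⨾ inc N₃) ⨾ pairs ls ⨾ move N₂ S ⨾ pair
         ⨾ pairs (1 ∷ 9 ∷ []) ⨾ move N₃ S ⨾ pair ⨾ simulate)

    main-⇓ : ∀ n {b} → Answers M (initial (target x₀ ks ls n)) b →
      ∃[ w ] main ⊢ state n n 0 0 0 0 0 0 0 (0 ∷ Vec.replicate r-1 0) ⇓ w × lookup w F ≡ flag b
    main-⇓ n {b} d with loop-⇓ d
    ... | w , e , eq-F = w , d′ , eq-F
      where
      v = Vec.replicate r-1 0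
      d′ : main ⊢ state n n 0 0 0 0 0 0 0 (0 ∷ v) ⇓ w
      d′ = incs-B x₀
        ( (wraps-⇓ ks n ⇓≡ cong₂ (λ n₃ b → state 0 n n₃ 0 0 0 0 0 0 (wraps ks n b ∷ v))
                             (+-identityʳ n) (+-identityʳ x₀))
        ⨾ pairs-⇓ ls
        ⨾ (move-N₂-S {n₂ = 0} n ⇓≡ cong (λ s → state 0 0 n s 0 0 0 0 0 (wrap ls (wraps ks n x₀) ∷ v)) (+-identityʳ n))
        ⨾ pair-⇓ {a = n} {b = wrap ls (wraps ks n x₀)}
        ⨾ pairs-⇓ (1 ∷ 9 ∷ [])
        ⨾ (move-N₃-S {n₃ = 0} n ⇓≡ cong (λ s → state 0 0 0 s 0 0 0 0 0
             (wrap (1 ∷ 9 ∷ []) ⟨ n , wrap ls (wraps ks n x₀) ⟩ ∷ v)) (+-identityʳ n))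
        ⨾ pair-⇓ {a = n} {b = wrap (1 ∷ 9 ∷ []) ⟨ n , wrap ls (wraps ks n x₀) ⟩}
        ⨾ inc
        ⨾ e)

-- Automata and their runs

-- A product of finite types, so that equality of operations is decidable componentwise.
Op : ℕ → Set
Op R = Fin 3 × Fin R

pattern incr r = zero , r
pattern decr r = suc zero , r
pattern test r = suc (suc zero) , r

Effect : ∀ {R} → Op R → Vec ℕ R → Vec ℕ R → Set
Effect (incr r) v w = w ≡ updateAt v r suc
Effect (decr r) v w = lookup v r ≢ 0 × w ≡ updateAt v r pred
Effect (test r) v w = lookup v r ≡ 0 × w ≡ v

Effect-functional : ∀ {R} (o : Op R) {v w w′} → Effect o v w → Effect o v w′ → w ≡ w′
Effect-functional (incr r) refl       refl       = refl
Effect-functional (decr r) (_ , refl) (_ , refl) = refl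
Effect-functional (test r) (_ , refl) (_ , refl) = refl

record Automaton : Set₁ where
  field
    registers size : ℕ
    X              : Set
    enum           : X ↔ Fin size
    op             : X → Op registers
    first          : List X
    next           : X → List X
    start load final : X

module Runs (𝔄 : Automaton) (n : ℕ) where
  open Automaton 𝔄

  options : List X → List X
  options []      = first
  options (a ∷ _) = next a

  -- The letters that may occur at position k when `start` has to be preceded
  -- by exactly 2n letters, the even ones among them being `load`.
  Admissible : ℕ → X → Set
  Admissible k a = (∀ j → j < n → k ≡ j * 2 → a ≢ start) × (k ≡ n * 2 → a ≢ load)

  -- Histories list the most recent letter first.
  data Run : List X → Vec ℕ registers → Set where
    []   : Run [] (Vec.replicate registers 0)
    step : ∀ {h v a w} → Run h v → a ∈ options h → Admissible (length h) a →
           Effect (op a) v w → Run (a ∷ h) w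

  -- A strategy may follow any run whatsoever. To conclude from one failing computation that no run
  -- of a given length exists, every letter on the way must have been the only possible one.
  data Forced : List X → Vec ℕ registers → Set where
    []   : Forced [] (Vec.replicate registers 0)
    step : ∀ {h v a w} → Forced h v → a ∈ options h → Admissible (length h) a →
           Effect (op a) v w →
           (∀ {b u} → b ∈ options h → Admissible (length h) b → Effect (op b) v u → b ≡ a) →
           Forced (a ∷ h) w

  Forced⇒Run : ∀ {h v} → Forced h v → Run h v
  Forced⇒Run []                   = []
  Forced⇒Run (step f a∈ adm e _) = step (Forced⇒Run f) a∈ adm e

  Forced-unique : ∀ {h v h′ v′} → Forced h v → Run h′ v′ → length h′ ≡ length h →
                  h′ ≡ h × v′ ≡ v
  Forced-unique [] [] eq = refl , refl
  Forced-unique (step f a∈ adm e only) (step r b∈ adm′ e′) eq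
    with Forced-unique f r (suc-injective eq)
  ... | refl , refl with only b∈ adm′ e′
  ... | refl = refl , Effect-functional (op _) e′ e

-- Compiling counter programs into automata

branches : {Y : Set} → (Bool → Y) → List Y
branches e = e true ∷ e false ∷ []

module _ {R : ℕ} where

  -- A loop or a conditional has two letters, `true` for the decrement and `false` for the zero
  -- test. Exactly one of them can be performed, so offering both as options still gives a
  -- deterministic branch.
  Letters : Prog R → Set
  Letters skip        = ⊥
  Letters (inc r)     = ⊤
  Letters (P ⨾ Q)     = Letters P ⊎ Letters Q
  Letters (loop r P)  = Bool ⊎ Letters P
  Letters (ifz r P Q) = Bool ⊎ (Letters P ⊎ Letters Q)

  #letters : Prog R → ℕ
  #letters skip        = 0
  #letters (inc r)     = 1
  #letters (P ⨾ Q)     = #letters P + #letters Q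
  #letters (loop r P)  = 2 + #letters P
  #letters (ifz r P Q) = 2 + (#letters P + #letters Q)

  letters : ∀ P → (Letters P) ↔ (Fin (#letters P))
  letters skip        = ↔-sym 0↔⊥
  letters (inc r)     = ↔-sym 1↔⊤
  letters (P ⨾ Q)     = ↔-sym +↔⊎ ↔-∘ (letters P ⊎-↔ letters Q)
  letters (loop r P)  = ↔-sym +↔⊎ ↔-∘ ((↔-sym 2↔Bool) ⊎-↔ letters P)
  letters (ifz r P Q) =
    ↔-sym +↔⊎ ↔-∘ ((↔-sym 2↔Bool) ⊎-↔ (↔-sym +↔⊎ ↔-∘ (letters P ⊎-↔ letters Q)))

  branch : Fin R → Bool → Op R
  branch r true  = decr r
  branch r false = test r

  operation : ∀ P → Letters P → Op R
  operation (inc r)     tt              = incr r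
  operation (P ⨾ Q)     (inj₁ a)        = operation P a
  operation (P ⨾ Q)     (inj₂ a)        = operation Q a
  operation (loop r P)  (inj₁ b)        = branch r b
  operation (loop r P)  (inj₂ a)        = operation P a
  operation (ifz r P Q) (inj₁ b)        = branch r b
  operation (ifz r P Q) (inj₂ (inj₁ a)) = operation P a
  operation (ifz r P Q) (inj₂ (inj₂ a)) = operation Q a

  module _ {Y : Set} where

    -- The letters of P are embedded by e; k lists the letters that may follow P.
    firsts : ∀ P → (Letters P → Y) → List Y → List Y
    firsts skip        e k = k
    firsts (inc r)     e k = e tt ∷ []
    firsts (P ⨾ Q)     e k = firsts P (e ∘ inj₁) (firsts Q (e ∘ inj₂) k)
    firsts (loop r P)  e k = branches (e ∘ inj₁)
    firsts (ifz r P Q) e k = branches (e ∘ inj₁)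

    follows : ∀ P → (Letters P → Y) → List Y → Letters P → List Y
    follows (inc r)     e k tt              = k
    follows (P ⨾ Q)     e k (inj₁ a)        = follows P (e ∘ inj₁) (firsts Q (e ∘ inj₂) k) a
    follows (P ⨾ Q)     e k (inj₂ a)        = follows Q (e ∘ inj₂) k a
    follows (loop r P)  e k (inj₁ true)     = firsts P (e ∘ inj₂) (branches (e ∘ inj₁))
    follows (loop r P)  e k (inj₁ false)    = k
    follows (loop r P)  e k (inj₂ a)        = follows P (e ∘ inj₂) (branches (e ∘ inj₁)) a
    follows (ifz r P Q) e k (inj₁ true)     = firsts Q (e ∘ inj₂ ∘ inj₂) k
    follows (ifz r P Q) e k (inj₁ false)    = firsts P (e ∘ inj₂ ∘ inj₁) k
    follows (ifz r P Q) e k (inj₂ (inj₁ a)) = follows P (e ∘ inj₂ ∘ inj₁) k a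
    follows (ifz r P Q) e k (inj₂ (inj₂ a)) = follows Q (e ∘ inj₂ ∘ inj₂) k a

pattern start-letter = inj₁ zero
pattern load₁-letter = inj₁ (suc zero)
pattern load₂-letter = inj₁ (suc (suc zero))
pattern halt-letter  = inj₁ (suc (suc (suc zero)))

module Control {m : ℕ} (P : Prog (Registers {m})) where

  private
    V = Vec ℕ (Registers {m})
    X = Fin 4 ⊎ Letters P

  -- `F` is zero during loading, so the test at `start-letter` always succeeds and the letter only
  -- marks the end of the input. At `halt-letter` the same test excludes a positive answer of the
  -- simulated machine.
  op : X → Op (Registers {m})
  op start-letter = test F
  op load₁-letter = incr N₁
  op load₂-letter = incr N₂
  op halt-letter  = test F
  op (inj₂ a)     = operation P a

  next : X → List X
  next start-letter = firsts P inj₂ (halt-letter ∷ [])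
  next load₁-letter = load₂-letter ∷ []
  next load₂-letter = load₁-letter ∷ start-letter ∷ []
  -- Idling makes an accepting run extendable to every length.
  next halt-letter  = halt-letter ∷ []
  next (inj₂ a)     = follows P inj₂ (halt-letter ∷ []) a

  control : Automaton
  control = record
    { registers = Registers {m}
    ; size      = 4 + #letters P
    ; X         = X
    ; enum      = ↔-sym +↔⊎ ↔-∘ (↔-id (Fin 4) ⊎-↔ letters P)
    ; op        = op
    ; first     = load₁-letter ∷ start-letter ∷ []
    ; next      = next
    ; start     = start-letter
    ; load      = load₁-letter
    ; final     = halt-letter
    }

  -- A forced stretch inside the program. `Admissible` restricts only the letters of the loading
  -- phase, so here uniqueness comes from the effects alone and the history can be left out. The
  -- options at both ends make stretches composable.
  data Path : List X → V → List X → V → Set where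
    done : ∀ {os v} → Path os v os v
    step : ∀ {os v w os′ v′} a → inj₂ a ∈ os → Effect (operation P a) v w →
           (∀ {b u} → b ∈ os → Effect (op b) v u → b ≡ inj₂ a) →
           Path (next (inj₂ a)) w os′ v′ → Path os v os′ v′

  _++ᴾ_ : ∀ {os v os′ v′ os″ v″} → Path os v os′ v′ → Path os′ v′ os″ v″ → Path os v os″ v″
  done              ++ᴾ q = q
  step a a∈ e f p ++ᴾ q = step a a∈ e f (p ++ᴾ q)

  private
    -- `op` and `next` are defined on the whole program; this lets `path` recurse into a subprogram.
    -- For the whole program both conditions hold by computation, and composing `e` with an
    -- injection preserves them.
    Embeds : ∀ Q → (Letters Q → Letters P) → List X → Set
    Embeds Q e k = (∀ a → operation P (e a) ≡ operation Q a)
                 × (∀ a → next (inj₂ (e a)) ≡ follows Q (inj₂ ∘ e) k a)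

  module _ {os′ : List X} {v v′ : V} (r : Fin Registers) (e : Bool → Letters P)
           (eq : ∀ b → operation P (e b) ≡ branch r b) where

    take-dec : ∀ {n} → lookup v r ≡ suc n → Path (next (inj₂ (e true))) (updateAt v r pred) os′ v′ →
               Path (branches (inj₂ ∘ e)) v os′ v′
    take-dec v≡ p = step (e true) (here refl)
      (subst (λ o → Effect o v _) (sym (eq true)) ((λ v≡0 → 0≢1+n (trans (sym v≡0) v≡)) , refl)) only p
      where
      only : ∀ {b u} → b ∈ branches (inj₂ ∘ e) → Effect (op b) v u → b ≡ inj₂ (e true)
      only (here refl) _ = refl
      only (there (here refl)) eff =
        contradiction (trans (sym (proj₁ (subst (λ o → Effect o v _) (eq false) eff))) v≡) 0≢1+n

    take-test : lookup v r ≡ 0 → Path (next (inj₂ (e false))) v os′ v′ → Path (branches (inj₂ ∘ e)) v os′ v′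
    take-test v≡ p = step (e false) (there (here refl))
      (subst (λ o → Effect o v _) (sym (eq false)) (v≡ , refl)) only p
      where
      only : ∀ {b u} → b ∈ branches (inj₂ ∘ e) → Effect (op b) v u → b ≡ inj₂ (e false)
      only (here refl) eff =
        contradiction v≡ (proj₁ (subst (λ o → Effect o v _) (eq true) eff))
      only (there (here refl)) _ = refl

  path : ∀ {Q e k v w} → Embeds Q e k → Q ⊢ v ⇓ w → Path (firsts Q (inj₂ ∘ e) k) v k w
  path em skip = done
  path {Q = inc r} {e} {k} {v} {w} (eo , en) inc = step (e tt) (here refl)
    (subst (λ o → Effect o v w) (sym (eo tt)) refl) (λ { (here refl) _ → refl })
    (subst (λ os → Path os w k w) (sym (en tt)) done)
  path (eo , en) (d ⨾ d′) =
    path ((eo ∘ inj₁) , (en ∘ inj₁)) d ++ᴾ path ((eo ∘ inj₂) , (en ∘ inj₂)) d′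
  path {Q = loop r _} {e} {k} {v} (eo , en) (loop-end v≡) =
    take-test r (e ∘ inj₁) (eo ∘ inj₁) v≡ (subst (λ os → Path os v k v) (sym (en (inj₁ false))) done)
  path {Q = loop r _} {e} em@(eo , en) (loop-go v≡ d d′) =
    take-dec r (e ∘ inj₁) (eo ∘ inj₁) v≡ (subst (λ os → Path os _ _ _) (sym (en (inj₁ true)))
      (path ((eo ∘ inj₂) , (en ∘ inj₂)) d ++ᴾ path em d′))
  path {Q = ifz r _ _} {e} (eo , en) (ifz-zero v≡ d) =
    take-test r (e ∘ inj₁) (eo ∘ inj₁) v≡ (subst (λ os → Path os _ _ _) (sym (en (inj₁ false)))
      (path ((eo ∘ inj₂ ∘ inj₁) , (en ∘ inj₂ ∘ inj₁)) d))
  path {Q = ifz r _ _} {e} (eo , en) (ifz-suc v≡ d) =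
    take-dec r (e ∘ inj₁) (eo ∘ inj₁) v≡ (subst (λ os → Path os _ _ _) (sym (en (inj₁ true)))
      (path ((eo ∘ inj₂ ∘ inj₂) , (en ∘ inj₂ ∘ inj₂)) d))

  loaded : ℕ → V
  loaded j = j ∷ j ∷ Vec.replicate _ 0

  module _ (n : ℕ) where
    open Runs control n

    follow-path : ∀ {os v os′ v′ h} → Path os v os′ v′ → Forced h v → options h ≡ os →
                  ∃[ h′ ] Forced h′ v′ × options h′ ≡ os′
    follow-path done                f eq   = _ , f , eq
    follow-path (step a a∈ e only p) f refl =
      follow-path p (step f a∈ ((λ _ _ _ ()) , λ _ ()) e (λ b∈ _ → only b∈)) refl

    -- After an even number of loads the counters permit both `load₁-letter` and `start-letter`.
    -- Only admissibility decides between them: it bars `start-letter` before position 2n and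
    -- `load₁-letter` at that position.
    loads : ∀ j → j ≤ n →
      ∃[ h ] Forced h (loaded j) × length h ≡ j * 2 × options h ≡ load₁-letter ∷ start-letter ∷ []
    loads zero    _   = [] , [] , refl , refl
    loads (suc j) j<n with loads j (<⇒≤ j<n)
    ... | h , f , eq , os = load₂-letter ∷ load₁-letter ∷ h
      , step (step f (subst (_ ∈_) (sym os) (here refl)) ((λ _ _ _ ()) , λ eq′ _ → j≢n (trans (sym eq) eq′)) refl only)
             (here refl) ((λ _ _ _ ()) , λ _ ()) refl (λ { (here refl) _ _ → refl })
      , cong (2 +_) eq , refl
      where
      j≢n : j * 2 ≢ n * 2
      j≢n eq = <⇒≢ j<n (*-cancelʳ-≡ j n 2 eq)
      only : ∀ {b u} → b ∈ options h → Admissible (length h) b → Effect (op b) (loaded j) u → b ≡ load₁-letter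
      only b∈ adm _ with subst (_ ∈_) os b∈
      ... | here refl         = refl
      ... | there (here refl) = contradiction refl (proj₁ adm j j<n eq)

    started : ∃[ h ] Forced (start-letter ∷ h) (loaded n)
    started with loads n ≤-refl
    ... | h , f , eq , os = h
      , step f (subst (_ ∈_) (sym os) (there (here refl)))
          ((λ j j<n eq′ _ → <⇒≢ j<n (*-cancelʳ-≡ j n 2 (trans (sym eq′) eq))) , λ _ ())
          (refl , refl) only
      where
      only : ∀ {b u} → b ∈ options h → Admissible (length h) b → Effect (op b) (loaded n) u → b ≡ start-letter
      only b∈ adm _ with subst (_ ∈_) os b∈
      ... | here refl         = contradiction refl (proj₂ adm eq)
      ... | there (here refl) = refl

    finished : ∀ {w} → P ⊢ loaded n ⇓ w → ∃[ h ] Forced h w × options h ≡ halt-letter ∷ []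
    finished d with started
    ... | h , f = follow-path (path ((λ _ → refl) , (λ _ → refl)) d) f refl

    accepting : ∀ {w} → P ⊢ loaded n ⇓ w → lookup w F ≡ 0 → ∃[ h ] ∃[ v ] Run (halt-letter ∷ h) v
    accepting {w} d eq with finished d
    ... | h , f , os = h , w
      , step (Forced⇒Run f) (subst (_ ∈_) (sym os) (here refl)) ((λ _ _ _ ()) , λ _ ()) (eq , refl)

    -- A run with one more letter than the forced history would extend that history by its only
    -- option `halt-letter`, whose test of `F` fails.
    rejecting : ∀ {w} → P ⊢ loaded n ⇓ w → lookup w F ≢ 0 → ∃[ k ] (∀ {h v} → Run h v → length h ≢ k)
    rejecting {w} d neq with finished d
    ... | h , f , os = suc (length h) , no-run
      where
      no-run : ∀ {h′ v} → Run h′ v → length h′ ≢ suc (length h)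
      no-run (step r a∈ adm e) eq with Forced-unique f r (suc-injective eq)
      ... | refl , refl with subst (_ ∈_) os a∈
      ... | here refl = neq (proj₁ e)

-- Lists are read backwards: the last element has index zero.
data _[_]=_ {A : Set} : List A → ℕ → A → Set where
  here  : ∀ {x xs k} → k ≡ length xs → (x ∷ xs) [ k ]= x
  there : ∀ {x y xs k} → xs [ k ]= y → (x ∷ xs) [ k ]= y

infix 4 _[_]=_

module _ {A : Set} where

  []=⇒< : ∀ {xs : List A} {k x} → xs [ k ]= x → k < length xs
  []=⇒< (here refl) = ≤-refl
  []=⇒< (there at)  = m≤n⇒m≤1+n ([]=⇒< at)

  <⇒[]= : ∀ (xs : List A) {k} → k < length xs → ∃[ x ] xs [ k ]= x
  <⇒[]= (z ∷ zs) {k} (s≤s k≤) with m≤n⇒m<n∨m≡n k≤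
  ... | inj₁ k< = map₂ there (<⇒[]= zs k<)
  ... | inj₂ eq = z , here eq

-- Runs over processes

module Tokens (𝔄 : Automaton) (n : ℕ) {P : Set} where
  open Automaton 𝔄
  open Runs 𝔄 n

  Marked : Op registers → P → List (X × P) → Set
  Marked o p h = ∃[ k ] ∃[ a ] h [ k ]= (a , p) × op a ≡ o

  extended : ∀ {o p h x} → Marked o p h → Marked o p (x ∷ h)
  extended (k , a , at , eq) = k , a , there at , eq

  unextended : ∀ {o p h a q} → op a ≢ o → Marked o p ((a , q) ∷ h) → Marked o p h
  unextended ≢ (k , a , here _ , eq)   = contradiction eq ≢
  unextended ≢ (k , a , there at , eq) = k , a , at , eq

  unextended′ : ∀ {o p h a q} → q ≢ p → Marked o p ((a , q) ∷ h) → Marked o p h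
  unextended′ ≢ (k , a , here _ , eq)   = contradiction refl ≢
  unextended′ ≢ (k , a , there at , eq) = k , a , at , eq

  -- A register holds the processes that incremented it and have not yet
  -- decremented it.
  Moves : Op registers → P → List (X × P) → (L L′ : Vec (List P) registers) → Set
  Moves (incr r) p h L L′ = ¬ Marked (incr r) p h × ¬ Marked (decr r) p h
                          × L′ ≡ updateAt L r (p ∷_)
  Moves (decr r) p h L L′ = ∃[ ps ] lookup L r ↭ p ∷ ps × L′ ≡ updateAt L r (const ps)
  Moves (test r) p h L L′ = lookup L r ≡ [] × L′ ≡ L

  data History : List (X × P) → Vec (List P) registers → Set where
    []   : History [] (Vec.replicate registers [])
    step : ∀ {h L a p L′} → History h L → a ∈ options (List.map proj₁ h) →
           Admissible (length h) a → Moves (op a) p h L L′ → History ((a , p) ∷ h) L′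

  admissible : ∀ {h L} → History h L → ∀ {k a p} → h [ k ]= (a , p) → Admissible k a
  admissible (step t _ adm _) (here refl) = adm
  admissible (step t _ adm _) (there at)  = admissible t at

  starts : ∀ {h L} → History h L → ∀ {a p} → h [ 0 ]= (a , p) → a ∈ first
  starts (step {h = []}    t a∈ _ _) (here refl) = a∈
  starts (step             t a∈ _ _) (there at)  = starts t at

  continues : ∀ {h L} → History h L → ∀ {k a p b q} → h [ k ]= (a , p) → h [ suc k ]= (b , q) →
              b ∈ next a
  continues (step t _ _ _) (here refl) (here eq)  = contradiction eq 1+n≢n
  continues (step t _ _ _) (here refl) (there at) = contradiction ([]=⇒< at) (<⇒≱ ≤-refl ∘ <⇒≤)
  continues (step (step t _ _ _) b∈ _ _) (there (here refl)) (here refl) = b∈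
  continues (step {h = _ ∷ _} t b∈ _ _) (there (there at))  (here refl) =
    contradiction ([]=⇒< at) (n≮n _)
  continues (step t _ _ _) (there at) (there at′) = continues t at at′

  -- This makes the contents of a register readable from the word without any order on its letters,
  -- which is what FO² can express. Uniqueness guarantees that a decremented process leaves no
  -- second copy behind.
  record Invariant (h : List (X × P)) (L : Vec (List P) registers) : Set where
    field
      sound    : ∀ {r p} → p ∈ lookup L r → Marked (incr r) p h × ¬ Marked (decr r) p h
      complete : ∀ {r p} → Marked (incr r) p h → ¬ Marked (decr r) p h → p ∈ lookup L r
      unique   : ∀ r → Unique (lookup L r)

  open Invariant

  private
    incr≢decr : ∀ {o : Op registers} {r r′} → o ≡ incr r → o ≢ decr r′
    incr≢decr refl ()

    decr≢incr : ∀ {o : Op registers} {r r′} → o ≡ decr r → o ≢ incr r′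
    decr≢incr refl ()

    decr≢decr : ∀ {o : Op registers} {r r′} → r ≢ r′ → o ≡ decr r → o ≢ decr r′
    decr≢decr ≢ refl refl = ≢ refl

    test≢incr : ∀ {o : Op registers} {r r′} → o ≡ test r → o ≢ incr r′
    test≢incr refl ()

    test≢decr : ∀ {o : Op registers} {r r′} → o ≡ test r → o ≢ decr r′
    test≢decr refl ()

  module _ {h : List (X × P)} {L : Vec (List P) registers} {a : X} {p : P} (I : Invariant h L) where

    invariant-step : ∀ o → op a ≡ o → ∀ {L′} → Moves o p h L L′ → Invariant ((a , p) ∷ h) L′
    invariant-step (incr r) eq {L′} (¬i , ¬d , refl) = record
      { sound = sound′ ; complete = complete′ ; unique = unique′ }
      where
      at-r : lookup L′ r ≡ p ∷ lookup L r
      at-r = lookup∘updateAt r L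
      off-r : ∀ {r′} → r ≢ r′ → lookup L′ r′ ≡ lookup L r′
      off-r {r′} r≢ = lookup∘updateAt′ r′ r (r≢ ∘ sym) L

      keep : ∀ {r′ q} → q ∈ lookup L r′ →
             Marked (incr r′) q ((a , p) ∷ h) × ¬ Marked (decr r′) q ((a , p) ∷ h)
      keep q∈ = extended (proj₁ (sound I q∈)) , proj₂ (sound I q∈) ∘ unextended (incr≢decr eq)

      sound′ : ∀ {r′ q} → q ∈ lookup L′ r′ →
               Marked (incr r′) q ((a , p) ∷ h) × ¬ Marked (decr r′) q ((a , p) ∷ h)
      sound′ {r′} q∈ with r Fin.≟ r′
      ... | no r≢ = keep (subst (_ ∈_) (off-r r≢) q∈)
      ... | yes refl with subst (_ ∈_) at-r q∈
      ...   | here refl = (_ , a , here refl , eq) , ¬d ∘ unextended (incr≢decr eq)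
      ...   | there q∈′ = keep q∈′

      complete′ : ∀ {r′ q} → Marked (incr r′) q ((a , p) ∷ h) →
                  ¬ Marked (decr r′) q ((a , p) ∷ h) → q ∈ lookup L′ r′
      complete′ {r′} (k , b , here _ , eq′) ¬dec with trans (sym eq) eq′
      ... | refl = subst (_ ∈_) (sym at-r) (here refl)
      complete′ {r′} (k , b , there at , eq′) ¬dec with r Fin.≟ r′
      ... | no r≢ = subst (_ ∈_) (sym (off-r r≢)) (complete I (k , b , at , eq′) (¬dec ∘ extended))
      ... | yes refl = subst (_ ∈_) (sym at-r) (there (complete I (k , b , at , eq′) (¬dec ∘ extended)))

      unique′ : ∀ r′ → Unique (lookup L′ r′)
      unique′ r′ with r Fin.≟ r′
      ... | no r≢ = subst Unique (sym (off-r r≢)) (unique I r′)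
      ... | yes refl = subst Unique (sym at-r)
        (All.tabulate (λ q∈ p≡q → ¬i (proj₁ (sound I (subst (_∈ _) (sym p≡q) q∈)))) ∷ unique I r)
    invariant-step (decr r) eq {L′} (ps , perm , refl) = record
      { sound = sound′ ; complete = complete′ ; unique = unique′ }
      where
      at-r : lookup L′ r ≡ ps
      at-r = lookup∘updateAt r L
      off-r : ∀ {r′} → r ≢ r′ → lookup L′ r′ ≡ lookup L r′
      off-r {r′} r≢ = lookup∘updateAt′ r′ r (r≢ ∘ sym) L

      unique-r : Unique (p ∷ ps)
      unique-r = Permutation.Unique-resp-↭ (setoid P) (↭⇒↭ₛ perm) (unique I r)

      p∉ : ∀ {q} → q ∈ ps → p ≢ q
      p∉ q∈ with unique-r
      ... | p≢ ∷ _ = All.lookup p≢ q∈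

      sound′ : ∀ {r′ q} → q ∈ lookup L′ r′ →
               Marked (incr r′) q ((a , p) ∷ h) × ¬ Marked (decr r′) q ((a , p) ∷ h)
      sound′ {r′} q∈ with r Fin.≟ r′
      ... | no r≢ = extended (proj₁ s) , proj₂ s ∘ unextended (decr≢decr r≢ eq)
        where s = sound I (subst (_ ∈_) (off-r r≢) q∈)
      ... | yes refl = extended (proj₁ s) , proj₂ s ∘ unextended′ (p∉ q∈′)
        where q∈′ = subst (_ ∈_) at-r q∈
              s = sound I (∈-resp-↭ (↭-sym perm) (there q∈′))

      complete′ : ∀ {r′ q} → Marked (incr r′) q ((a , p) ∷ h) →
                  ¬ Marked (decr r′) q ((a , p) ∷ h) → q ∈ lookup L′ r′
      complete′ {r′} up ¬dec with r Fin.≟ r′ | complete I (unextended (decr≢incr eq) up) (¬dec ∘ extended)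
      ... | no r≢ | q∈ = subst (_ ∈_) (sym (off-r r≢)) q∈
      ... | yes refl | q∈ with ∈-resp-↭ perm q∈
      ...   | here refl = contradiction (_ , a , here refl , eq) ¬dec
      ...   | there q∈′ = subst (_ ∈_) (sym at-r) q∈′

      unique′ : ∀ r′ → Unique (lookup L′ r′)
      unique′ r′ with r Fin.≟ r′ | unique-r
      ... | no r≢    | _     = subst Unique (sym (off-r r≢)) (unique I r′)
      ... | yes refl | _ ∷ u = subst Unique (sym at-r) u
    invariant-step (test r) eq (_ , refl) = record
      { sound    = λ q∈ → extended (proj₁ (sound I q∈)) , proj₂ (sound I q∈) ∘ unextended (test≢decr eq)
      ; complete = λ up ¬dec → complete I (unextended (test≢incr eq) up) (¬dec ∘ extended)
      ; unique   = unique I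
      }

  invariant : ∀ {h L} → History h L → Invariant h L
  invariant [] = record
    { sound    = λ {r} q∈ → contradiction (subst (_ ∈_) (lookup-replicate r []) q∈) λ ()
    ; complete = λ { (_ , _ , () , _) }
    ; unique   = λ r → subst Unique (sym (lookup-replicate r [])) []
    }
  invariant (step {a = a} t _ _ mv) = invariant-step (invariant t) (op a) refl mv

  -- The conditions imposed by the game formula, stated for histories. Existence is known only up to
  -- double negation, as in the semantics, whereas an equation of positions is decidable and hence
  -- stable.
  Once Matched : List (X × P) → Set
  Once h = ∀ {i j a b p} → h [ i ]= (a , p) → h [ j ]= (b , p) →
           op b ≡ op a → (∀ r → op a ≢ test r) → i ≡ j
  Matched h = ∀ {i a p r} → h [ i ]= (a , p) → op a ≡ decr r → ¬ ¬ Marked (incr r) p h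

  Emptied : X → List (X × P) → Set
  Emptied a h = ∀ {p r} → op a ≡ test r → Marked (incr r) p h → ¬ ¬ Marked (decr r) p h

  private
    fresh : ∀ {h L a p L′} → Invariant h L → ∀ o → Moves o p h L L′ → op a ≡ o →
            (∀ r → o ≢ test r) → ¬ Marked o p h
    fresh I (incr r) (¬i , _) eq _ = ¬i
    fresh I (decr r) (ps , perm , _) eq _ = proj₂ (sound I (∈-resp-↭ (↭-sym perm) (here refl)))
    fresh I (test r) mv eq ≢ = contradiction refl (≢ r)

  once : ∀ {h L} → History h L → Once h
  once (step t _ _ mv) (here eq)  (here eq′)  _  _ = trans eq (sym eq′)
  once (step {a = a} t _ _ mv) (here eq)  (there at′) op≡ ≢ =
    contradiction (_ , _ , at′ , op≡) (fresh {a = a} (invariant t) (op a) mv refl ≢)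
  once (step {a = a} t _ _ mv) (there at) (here eq′)  op≡ ≢ =
    contradiction (_ , _ , at , sym op≡)
      (fresh {a = a} (invariant t) (op a) mv refl (λ r e → ≢ r (trans (sym op≡) e)))
  once (step t _ _ mv) (there at) (there at′) op≡ ≢ = once t at at′ op≡ ≢

  matched : ∀ {h L} → History h L → ∀ {i a p r} → h [ i ]= (a , p) → op a ≡ decr r → Marked (incr r) p h
  matched (step t _ _ mv) (there at) eq = extended (matched t at eq)
  matched (step {a = a} t _ _ mv) (here _) eq with op a
  matched (step t _ _ (ps , perm , _)) (here _) refl | decr r =
    extended (proj₁ (sound (invariant t) (∈-resp-↭ (↭-sym perm) (here refl))))

  emptied : ∀ {h L a q} → History ((a , q) ∷ h) L → Emptied a ((a , q) ∷ h)
  emptied {a = a} (step t _ _ mv) {p} {r} eq up ¬dec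
    with subst (λ o → Moves o _ _ _ _) eq mv
  ... | empty , refl = contradiction
    (subst (p ∈_) empty (complete (invariant t) (unextended (test≢incr eq) up) (¬dec ∘ extended)))
    λ ()

  -- Conditions on the longer history yield a legal last move. An increment needs a process with
  -- neither mark: `Once` excludes an earlier increment, and an earlier decrement would have been
  -- matched by one. For a decrement, the matching increment puts the process into the list; for a
  -- test, any process left in the list would contradict `Emptied`.
  extend : ∀ {h L a p} → History h L → Once ((a , p) ∷ h) → Matched ((a , p) ∷ h) →
           Emptied a ((a , p) ∷ h) → ∀ o → op a ≡ o → ¬ ¬ (∃[ L′ ] Moves o p h L L′)
  extend {h} {L} {a} {p} t on ma em (incr r) eq stuck = stuck (_ , ¬up , ¬dec , refl)
    where
    ¬up : ¬ Marked (incr r) p h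
    ¬up (k , b , at , eq′) =
      <⇒≢ ([]=⇒< at) (on (there at) (here refl) (trans eq (sym eq′))
        λ _ eq″ → test≢incr eq″ eq′)
    ¬dec : ¬ Marked (decr r) p h
    ¬dec (k , b , at , eq′) = ¬up (matched t at eq′)
  extend {h} {L} {a} {p} t on ma em (decr r) eq stuck = ma (here refl) eq λ up →
    stuck (removed (complete (invariant t) (unextended (decr≢incr eq) up) ¬dec))
    where
    ¬dec : ¬ Marked (decr r) p h
    ¬dec (k , b , at , eq′) =
      <⇒≢ ([]=⇒< at) (on (there at) (here refl) (trans eq (sym eq′))
        λ _ eq″ → test≢decr eq″ eq′)
    removed : p ∈ lookup L r → ∃[ L′ ] Moves (decr r) p h L L′
    removed p∈ with ∈-∃++ p∈
    ... | xs , ys , split = _ , xs ++ ys , ↭-trans (↭-reflexive split) (shift p xs ys) , refl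
  extend {h} {L} {a} {p} t on ma em (test r) eq stuck with lookup L r in eq-L
  ... | []    = stuck (L , refl , refl)
  ... | q ∷ _ = em eq (extended (proj₁ s)) (proj₂ s ∘ unextended (test≢decr eq))
    where s = sound (invariant t) (subst (q ∈_) (sym eq-L) (here refl))

  counters : ∀ {h L} → History h L → Run (List.map proj₁ h) (Vec.map length L)
  counters [] = subst (Run []) (sym (map-replicate length [] registers)) []
  counters (step {h} {L} {a} t a∈ adm mv) =
    step (counters t) a∈ (subst (λ k → Admissible k a) (sym (length-map proj₁ h)) adm) (effect (op a) mv)
    where
    effect : ∀ o {p L′} → Moves o p h L L′ → Effect o (Vec.map length L) (Vec.map length L′)
    effect (incr r) (_ , _ , refl) = map-updateAt L r refl
    effect (decr r) (ps , perm , refl) =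
      (λ eq → 0≢1+n (trans (sym eq) (trans (lookup-map r length L) (↭-length perm))))
      , map-updateAt L r (sym (cong pred (↭-length perm)))
    effect (test r) (empty , refl) = trans (lookup-map r length L) (cong length empty) , refl

module _ (𝔄 : Automaton) (n N : ℕ) where
  open Automaton 𝔄
  open Runs 𝔄 n
  open Tokens 𝔄 n {Fin N}

  Bounded : List (X × Fin N) → Set
  Bounded h = ∀ {k a p} → h [ k ]= (a , p) → toℕ p < length h

  tokens : ∀ {as v} → Run as v → length as ≤ N →
    ∃[ h ] ∃[ L ] History h L × List.map proj₁ h ≡ as × Vec.map length L ≡ v × Bounded h
  tokens [] _ = [] , _ , [] , refl , map-replicate length [] registers , λ ()
  tokens (step {a = a} r a∈ adm eff) as< with tokens r (<⇒≤ as<)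
  ... | h , L , t , refl , refl , bounded with perform (op a) eff
    where
    h<N : length h < N
    h<N = subst (_< N) (length-map proj₁ h) as<
    -- The length of the history is a process number above all those used so far, so one process per
    -- letter suffices. Tests take it as well, since every letter needs some process.
    new = fromℕ< h<N
    unused : ∀ {o} → ¬ Marked o new h
    unused (k , b , at , _) = <⇒≢ (bounded at) (toℕ-fromℕ< h<N)
    perform : ∀ o {v} → Effect o (Vec.map length L) v →
           ∃[ p ] ∃[ L′ ] Moves o p h L L′ × Vec.map length L′ ≡ v × toℕ p < suc (length h)
    perform (incr r) refl = new , _ , (unused , unused , refl) , map-updateAt L r refl
      , s≤s (≤-reflexive (toℕ-fromℕ< h<N))
    perform (decr r) (≢0 , refl) with lookup L r in eq
    ... | []     = contradiction (trans (lookup-map r length L) (cong length eq)) ≢0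
    ... | p ∷ ps = p , _ , (ps , ↭-refl , refl)
      , map-updateAt L r (sym (cong (pred ∘ length) eq))
      , m≤n⇒m≤1+n (bounded (proj₁ (proj₂ (proj₂ (proj₁ (Invariant.sound (invariant t)
          (subst (p ∈_) (sym eq) (here refl))))))))
    perform (test r) (≡0 , refl) = new , L , (empty , refl) , refl
      , s≤s (≤-reflexive (toℕ-fromℕ< h<N))
      where
      empty : lookup L r ≡ []
      empty with lookup L r in eq
      ... | []    = refl
      ... | _ ∷ _ = contradiction (trans (sym ≡0) (trans (lookup-map r length L) (cong length eq))) 0≢1+n
  ... | p , L′ , mv , eq , p< = (a , p) ∷ h , L′
    , step t a∈ (subst (λ k → Admissible k a) (length-map proj₁ h) adm) mv , refl , eq
    , λ { (here _) → p< ; (there at) → m≤n⇒m≤1+n (bounded at) }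

-- The game formula

alphabet : ℕ → Alphabet
alphabet s = record { ∣A-S∣ = s ; ∣A-E∣ = 1 }

-- The game is written over its `size` letters but played over an alphabet whose size is its own
-- code. A renaming that keeps the numbers of the letters keeps the code, which does not record the
-- alphabet.
relabel : ∀ {s s′ bx by} → (Fin s → Fin s′) → FO² (alphabet s) bx by → FO² (alphabet s′) bx by
relabel f (act (inj₁ a) u) = act (inj₁ (f a)) u
relabel f (act (inj₂ a) u) = act (inj₂ a) u
relabel f (u ≐ v)          = u ≐ v
relabel f (u ≐ v +1)       = u ≐ v +1
relabel f (u ∼ v)          = u ∼ v
relabel f (isS u)          = isS u
relabel f (isE u)          = isE u
relabel f (isSE u)         = isSE u
relabel f (neg φ)          = neg (relabel f φ)
relabel f (φ and ψ)        = relabel f φ and relabel f ψ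
relabel f (φ or ψ)         = relabel f φ or relabel f ψ
relabel f (existsx φ)      = existsx (relabel f φ)
relabel f (existsy φ)      = existsy (relabel f φ)
relabel f (allx φ)         = allx (relabel f φ)
relabel f (ally φ)         = ally (relabel f φ)

code-relabel : ∀ {s s′ bx by} (f : Fin s → Fin s′) → (∀ i → toℕ (f i) ≡ toℕ i) →
               (φ : FO² (alphabet s) bx by) → codeFO² (relabel f φ) ≡ codeFO² φ
code-relabel f eq (act (inj₁ a) u) = cong (λ i → ⟨ 0 , ⟨ i , codeVar u ⟩ ⟩) (eq a)
code-relabel f eq (act (inj₂ a) u) = refl
code-relabel f eq (u ≐ v)          = refl
code-relabel f eq (u ≐ v +1)       = refl
code-relabel f eq (u ∼ v)          = refl
code-relabel f eq (isS u)          = refl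
code-relabel f eq (isE u)          = refl
code-relabel f eq (isSE u)         = refl
code-relabel f eq (neg φ)          = cong ⟨ 8 ,_⟩ (code-relabel f eq φ)
code-relabel f eq (φ and ψ)        = cong₂ (λ i j → ⟨ 9 , ⟨ i , j ⟩ ⟩) (code-relabel f eq φ) (code-relabel f eq ψ)
code-relabel f eq (φ or ψ)         = cong₂ (λ i j → ⟨ 10 , ⟨ i , j ⟩ ⟩) (code-relabel f eq φ) (code-relabel f eq ψ)
code-relabel f eq (existsx φ)      = cong ⟨ 11 ,_⟩ (code-relabel f eq φ)
code-relabel f eq (existsy φ)      = cong ⟨ 12 ,_⟩ (code-relabel f eq φ)
code-relabel f eq (allx φ)         = cong ⟨ 13 ,_⟩ (code-relabel f eq φ)
code-relabel f eq (ally φ)         = cong ⟨ 14 ,_⟩ (code-relabel f eq φ)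

-- Opaque for the same reason that codes are abstracted over the pairing function.
opaque
  sentenceCode : ∀ {s} → Sentence (alphabet s) → ℕ
  sentenceCode φ = codeFO² φ

  sentenceCode≡codeFO² : ∀ {s} (φ : Sentence (alphabet s)) → sentenceCode φ ≡ codeFO² φ
  sentenceCode≡codeFO² φ = refl

module Formulas (𝔄 : Automaton) where
  open Automaton 𝔄

  private
    FO = FO² (alphabet size)

  all : List X
  all = List.map (Inverse.from enum) (allFin size)

  ∈-all : ∀ a → a ∈ all
  ∈-all a = subst (_∈ all) (Inverse.strictlyInverseʳ enum a)
    (∈-map⁺ (Inverse.from enum) (∈-allFin (Inverse.to enum a)))

  _≟_ : (o o′ : Op registers) → Dec (o ≡ o′)
  _≟_ = ≡-dec Fin._≟_ Fin._≟_

  letter : ∀ {bx by} → X → Var bx by → FO bx by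
  letter a = act (inj₁ (Inverse.to enum a))

  env : ∀ {bx by} → Var bx by → FO bx by
  env = act (inj₂ zero)

  _implies_ : ∀ {bx by} → FO bx by → FO bx by → FO bx by
  φ implies ψ = neg φ or ψ

  some every : ∀ {bx by} → List X → (X → FO bx by) → FO bx by
  some  []       φ = neg (allx (x ≐ x))
  some  (a ∷ as) φ = φ a or some as φ
  every []       φ = allx (x ≐ x)
  every (a ∷ as) φ = φ a and every as φ

  performing : Op registers → List X
  performing o = filter (λ a → op a ≟ o) all

  does : ∀ {bx by} → Op registers → Var bx by → FO bx by
  does o u = some (performing o) (λ a → letter a u)

  -- Process elements have no predecessor either, so `startsᶠ` exempts them. In `continuesᶠ` a
  -- System letter requires a System letter just before it; this is what lets Environment end the
  -- play. `haltsᶠ` then releases System from its duty to halt.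
  startsᶠ continuesᶠ haltsᶠ : FO false false
  startsᶠ = allx (isS x or (isE x or (existsy (x ≐ y +1) or
                   (env x or some first (λ a → letter a x)))))
  continuesᶠ = allx (ally ((y ≐ x +1) implies
    (env y or some all (λ a → letter a x and some (next a) (λ b → letter b y)))))
  haltsᶠ = existsx (env x) or existsx (letter final x)

  onceᶠ : Op registers → X → FO false false
  onceᶠ o a = allx (ally ((letter a x and (does o y and (x ∼ y))) implies (x ≐ y)))

  matchedᶠ emptiedᶠ : Fin registers → X → FO false false
  matchedᶠ r a = allx (letter a x implies existsy (does (incr r) y and (x ∼ y)))
  -- A test is checked only while it is the last letter of System: by reusing x,
  -- its position is forgotten in the search for decrements.
  emptiedᶠ r a = allx (letter a x implies
    (existsy ((y ≐ x +1) and neg (env y)) or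
     ally (does (incr r) y implies existsx (does (decr r) x and (x ∼ y)))))

  correctᶠ : Op registers → X → FO false false
  correctᶠ (incr r) a = onceᶠ (incr r) a
  correctᶠ (decr r) a = onceᶠ (decr r) a and matchedᶠ r a
  correctᶠ (test r) a = emptiedᶠ r a

  -- Valid; it makes the code of the game at least the number of its letters.
  padding : ∀ {bx by} → ℕ → FO bx by
  padding zero    = allx (x ≐ x)
  padding (suc k) = allx (padding k)

  -- Two successor steps lead from `x` over `y` back to `x`, so one level is a fixed context around
  -- the next. In `control` the odd positions of the loading phase need no condition, as the second
  -- load letter is the only one that may follow the first.
  loading : ∀ {by} → ℕ → FO true by
  loading zero    = neg (letter load x)
  loading (suc n) = neg (letter start x) and
    ally ((y ≐ x +1) implies allx ((x ≐ y +1) implies loading n))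

  game : FO false false
  game = padding size and (existsx (isE x) and (startsᶠ and (continuesᶠ and
    (every all (λ a → correctᶠ (op a) a) and haltsᶠ))))

  loadsᶠ : ℕ → FO false false
  loadsᶠ n = allx (existsy (x ≐ y +1) or loading n)

⟨,⟩-≥ : ∀ m n → m + n ≤ ⟨ m , n ⟩
⟨,⟩-≥ m n = ≤-trans (k≤triangle (m + n)) (m≤m+n _ n)
  where
  k≤triangle : ∀ k → k ≤ triangle k
  k≤triangle zero    = z≤n
  k≤triangle (suc k) = m≤m+n (suc k) (triangle k)

module _ (𝔄 : Automaton) where
  open Automaton 𝔄
  open Formulas 𝔄

  padding-code : ∀ {bx by} k → k ≤ codeFO² (padding {bx} {by} k)
  padding-code zero = z≤n
  padding-code {by = by} (suc k) = begin
    suc k                  ≤⟨ s≤s (padding-code k) ⟩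
    1 + z                  ≤⟨ +-monoˡ-≤ z (s≤s {0} {12} z≤n) ⟩
    13 + z                 ≤⟨ ⟨,⟩-≥ 13 z ⟩
    ⟨ 13 , z ⟩             ∎
    where
    open ≤-Reasoning
    z = codeFO² (padding {true} {by} k)

  code-≥ˡ : ∀ {s} {χ φ ψ : Sentence (alphabet s)} → χ ≡ φ and ψ → codeFO² φ ≤ sentenceCode χ
  code-≥ˡ {φ = φ} {ψ} refl = begin
    i               ≤⟨ m≤m+n i j ⟩
    i + j           ≤⟨ ⟨,⟩-≥ i j ⟩
    ⟨ i , j ⟩       ≤⟨ m≤n+m ⟨ i , j ⟩ 9 ⟩
    9 + ⟨ i , j ⟩   ≤⟨ ⟨,⟩-≥ 9 ⟨ i , j ⟩ ⟩
    ⟨ 9 , ⟨ i , j ⟩ ⟩ ≡⟨ sentenceCode≡codeFO² (φ and ψ) ⟨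
    sentenceCode (φ and ψ) ∎
    where
    open ≤-Reasoning
    i = codeFO² φ
    j = codeFO² ψ

  size≤code : size ≤ sentenceCode game
  size≤code = ≤-trans (padding-code size) (code-≥ˡ {χ = game} refl)

-- Satisfaction of the game formula

module Satisfaction (𝔄 : Automaton) (n s : ℕ) (size≤s : Automaton.size 𝔄 ≤ s) (𝒫 : Processes) where
  open Automaton 𝔄
  open Formulas 𝔄
  open Processes 𝒫
  open Runs 𝔄 n
  open Tokens 𝔄 n {ℙ-S}

  private
    𝔸 = alphabet s

  ι : X → Fin s
  ι a = inject≤ (Inverse.to enum a) size≤s

  ι-injective : ∀ {a b} → ι a ≡ ι b → a ≡ b
  ι-injective {a} {b} eq = trans (sym (Inverse.strictlyInverseʳ enum a))
    (trans (cong (Inverse.from enum) (inject≤-injective size≤s size≤s _ _ eq))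
           (Inverse.strictlyInverseʳ enum b))

  lift : ∀ {bx by} → FO² (alphabet size) bx by → FO² 𝔸 bx by
  lift = relabel (λ i → inject≤ i size≤s)

  ⌜_⌝ : X × ℙ-S → Letter 𝔸 𝒫
  ⌜ a , p ⌝ = inj₁ (ι a , p)

  module _ (w : DataWord 𝔸 𝒫) where

    index-injective : ∀ i j → index w i ≡ index w j → i ≡ j
    index-injective = go w
      where
      go : ∀ w i j → index {𝔸} {𝒫} w i ≡ index w j → i ≡ j
      go (finite _)   _ _ = Fin.toℕ-injective
      go (infinite _) _ _ = λ eq → eq

    -- System opens the word with `h`, and all letters beyond, if any, are Environment's. Both
    -- directions of the reduction need the formula only on such words.
    record Represents (h : List (X × ℙ-S)) : Set where
      field
        inside  : ∀ i {σ} → h [ index w i ]= σ → letterAt w i ≡ ⌜ σ ⌝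
        outside : ∀ i → length h ≤ index w i → ∃[ e ] letterAt w i ≡ inj₂ e
        present : ∀ {k} → k < length h → ∃[ i ] index w i ≡ k

    private
      ⟦_⟧ʷ : ∀ {bx by} → FO² (alphabet size) bx by → Value w bx × Value w by → Set
      ⟦ φ ⟧ʷ = ⟦_⟧ w (lift φ)

    module _ {bx by} {ρ : Value w bx × Value w by} (φ : X → FO² (alphabet size) bx by) where

      some-intro : ∀ {as a} → a ∈ as → ⟦ φ a ⟧ʷ ρ → ⟦ some as φ ⟧ʷ ρ
      some-intro (here refl) t (¬t , _) = ¬t t
      some-intro (there a∈)  t (_ , ¬t) = ¬t (some-intro a∈ t)

      some-elim : ∀ as → ⟦ some as φ ⟧ʷ ρ → ¬ ¬ (∃[ a ] a ∈ as × ⟦ φ a ⟧ʷ ρ)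
      some-elim []       t k = t (λ _ → refl)
      some-elim (a ∷ as) t k =
        t ((λ t → k (a , here refl , t)) , λ t → some-elim as t λ (b , b∈ , t) → k (b , there b∈ , t))

      every-intro : ∀ as → (∀ a → ⟦ φ a ⟧ʷ ρ) → ⟦ every as φ ⟧ʷ ρ
      every-intro []       t = λ _ → refl
      every-intro (a ∷ as) t = t a , every-intro as t

      every-elim : ∀ {as} → ⟦ every as φ ⟧ʷ ρ → ∀ {a} → a ∈ as → ⟦ φ a ⟧ʷ ρ
      every-elim (t , _) (here refl) = t
      every-elim (_ , t) (there a∈)  = every-elim t a∈

    module _ {bx by} {ρ : Value w bx × Value w by} (u : Var bx by) where

      does-intro : ∀ {a o} → op a ≡ o → HasAction w (inj₁ (ι a)) (value w u ρ) → ⟦ does o u ⟧ʷ ρ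
      does-intro {a} {o} eq = some-intro (λ a → letter a u) (∈-filter⁺ (λ a → op a ≟ o) (∈-all a) eq)

      does-elim : ∀ {o} → ⟦ does o u ⟧ʷ ρ → ¬ ¬ (∃[ a ] op a ≡ o × HasAction w (inj₁ (ι a)) (value w u ρ))
      does-elim {o} t k = some-elim (λ a → letter a u) (performing o) t λ (a , a∈ , t) →
        k (a , proj₂ (∈-filter⁻ (λ a → op a ≟ o) {xs = all} a∈) , t)

    left : ∀ {A B : Set} → A → ¬ (¬ A × ¬ B)
    left a (¬a , _) = ¬a a

    right : ∀ {A B : Set} → B → ¬ (¬ A × ¬ B)
    right b (_ , ¬b) = ¬b b

    implies-intro : ∀ {A B : Set} → (A → B) → ¬ (¬ ¬ A × ¬ B)
    implies-intro f (¬¬a , ¬b) = ¬¬a (¬b ∘ f)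

    implies-elim : ∀ {A B : Set} → ¬ (¬ ¬ A × ¬ B) → A → ¬ ¬ B
    implies-elim f a ¬b = f ((λ ¬a → ¬a a) , ¬b)

    env-at : ∀ {i e} → letterAt w i ≡ inj₂ e → HasAction w (inj₂ zero) (inj₁ i)
    env-at {e = zero , _} eq = cong action eq

    not-env : ∀ {i σ} → letterAt w i ≡ inj₁ σ → ¬ HasAction w (inj₂ zero) (inj₁ i)
    not-env eq env with trans (sym (cong action eq)) env
    ... | ()

    earlier : ∀ i {k} → k ≤ index w i → ∃[ j ] index w j ≡ k
    earlier = go w
      where
      go : ∀ w i {k} → k ≤ index {𝔸} {𝒫} w i → ∃[ j ] index w j ≡ k
      go (finite σs)  i k≤ = Fin.fromℕ< (<-≤-trans (s≤s k≤) (Fin.toℕ<n i)) , Fin.toℕ-fromℕ< _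
      go (infinite _) i k≤ = _ , refl

    module _ {h : List (X × ℙ-S)} (rep : Represents h) where
      open Represents rep

      at : ∀ i → (∃[ σ ] h [ index w i ]= σ) ⊎ (∃[ e ] letterAt w i ≡ inj₂ e)
      at i with index w i <? length h
      ... | yes i< = inj₁ (<⇒[]= h i<)
      ... | no i≮  = inj₂ (outside i (≮⇒≥ i≮))

      action-intro : ∀ {i a p} → h [ index w i ]= (a , p) → HasAction w (inj₁ (ι a)) (inj₁ i)
      action-intro {i} h≡ = cong action (inside i h≡)

      process-of : ∀ {i a p} → h [ index w i ]= (a , p) → process (letterAt w i) ≡ inj₁ p
      process-of {i} h≡ = cong process (inside i h≡)

      action-elim : ∀ {d a} → HasAction w (inj₁ (ι a)) d → ∃[ i ] ∃[ p ] d ≡ inj₁ i × h [ index w i ]= (a , p)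
      action-elim {inj₁ i} {a} eq with at i
      ... | inj₂ (e , eq′) = contradiction (trans (sym eq) (cong action eq′)) λ ()
      ... | inj₁ ((b , p) , h≡)
        with ι-injective (inj₁-injective (trans (sym eq) (cong action (inside i h≡))))
      ...   | refl = i , p , refl , h≡

      position : ∀ {k σ} → h [ k ]= σ → ∃[ i ] h [ index w i ]= σ × index w i ≡ k
      position h≡ with present ([]=⇒< h≡)
      ... | i , refl = i , h≡ , refl

      marked-intro : ∀ {bx by} (u : Var bx by) {ρ i o a p} → value w u ρ ≡ inj₁ i →
        h [ index w i ]= (a , p) → op a ≡ o → ⟦ does o u ⟧ʷ ρ
      marked-intro u eq h≡ eq-o =
        does-intro u eq-o (subst (HasAction w _) (sym eq) (action-intro h≡))

      -- Legal histories satisfy the formula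

      module _ {L} (t : History h L) where

        sat-starts : ⟦ startsᶠ ⟧ʷ (tt , tt)
        sat-starts (inj₂ (inj₁ p)) = left (p , refl)
        sat-starts (inj₂ (inj₂ p)) = right (left (p , refl))
        sat-starts (inj₁ i) with at i
        ... | inj₂ (e , eq) = right (right (right (left (env-at eq))))
        ... | inj₁ ((a , p) , h≡) with index w i in eq
        ...   | suc k = right (right (left λ none → none (inj₁ (proj₁ j)) (trans eq (cong suc (sym (proj₂ j))))))
          where j = earlier i (subst (k ≤_) (sym eq) (n≤1+n k))
        ...   | zero  = right (right (right (right
          (some-intro (λ a → letter a x) (starts t h≡) (action-intro (subst (h [_]= (a , p)) (sym eq) h≡))))))

        sat-continues : ⟦ continuesᶠ ⟧ʷ (tt , tt)
        sat-continues (inj₁ i) (inj₁ j) = implies-intro go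
          where
          go : index w j ≡ suc (index w i) → _
          go eq with at j
          ... | inj₂ (e , eq′) = left (env-at eq′)
          ... | inj₁ ((b , q) , h≡) with <⇒[]= h {index w i} (<⇒≤ (subst (_< length h) eq ([]=⇒< h≡)))
          ...   | (a , p) , h≡′ = right (some-intro (λ a → letter a x and some (next a) (λ b → letter b y))
            (∈-all a) (action-intro h≡′ ,
              some-intro (λ b → letter b y) (continues t h≡′ (subst (h [_]= _) eq h≡)) (action-intro h≡)))
        sat-continues (inj₁ _) (inj₂ _) = implies-intro λ ()
        sat-continues (inj₂ _) (inj₁ _) = implies-intro λ ()
        sat-continues (inj₂ _) (inj₂ _) = implies-intro λ ()

        sat-once : ∀ a → (∀ r → op a ≢ test r) → ⟦ onceᶠ (op a) a ⟧ʷ (tt , tt)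
        sat-once a ≢ d e (¬¬A , d≢e) = ¬¬A λ (da , eb , d∼e) → does-elim y eb λ (b , eq , eb) →
          same (action-elim da) (action-elim eb) eq d∼e
          where
          same : ∀ {b} → (∃[ i ] ∃[ p ] d ≡ inj₁ i × h [ index w i ]= (a , p)) →
                 (∃[ j ] ∃[ q ] e ≡ inj₁ j × h [ index w j ]= (b , q)) →
                 op b ≡ op a → processOf w d ≡ processOf w e → ⊥
          same (i , p , refl , h≡) (j , q , refl , h≡′) eq d∼e
            with inj₁-injective (trans (sym (process-of h≡)) (trans d∼e (process-of h≡′)))
          ... | refl = d≢e (cong inj₁ (index-injective i j (once t h≡ h≡′ eq ≢)))

        sat-marked : ∀ o {d q} → Marked o q h → processOf w d ≡ inj₁ q →
                     ∃[ i ] (∀ {bx by} {u : Var bx by} {ρ} → value w u ρ ≡ inj₁ i → ⟦ does o u ⟧ʷ ρ)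
                          × processOf w d ≡ process (letterAt w i)
        sat-marked o (k , a , h≡ , eq) d∼q with position h≡
        ... | i , h≡′ , _ = i , (λ {_} {_} {u} {ρ} v≡ → marked-intro u {ρ} v≡ h≡′ eq)
          , trans d∼q (sym (process-of h≡′))

        sat-matched : ∀ a r → op a ≡ decr r → ⟦ matchedᶠ r a ⟧ʷ (tt , tt)
        sat-matched a r eq d = implies-intro λ da → go (action-elim da)
          where
          go : (∃[ i ] ∃[ p ] d ≡ inj₁ i × h [ index w i ]= (a , p)) → _
          go (i , p , refl , h≡) none with sat-marked (incr r) {inj₁ i} (matched t h≡ eq) (process-of h≡)
          ... | j , ja , i∼j = none (inj₁ j) (ja {u = y} refl , i∼j)

        -- A test before the end of `h` is followed by a letter of System, which the first disjunct
        -- accepts. For the last letter, all increments in the word lie in `h`, and the legal move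
        -- has found the register empty.
        sat-emptied : ∀ a r → op a ≡ test r → ⟦ emptiedᶠ r a ⟧ʷ (tt , tt)
        sat-emptied a r eq d = implies-intro λ da → go (action-elim da)
          where
          last : ∀ {h L i p} → History h L → h [ i ]= (a , p) → suc i ≡ length h → Emptied a h
          last t (here _)   _    = emptied t
          last t (there h≡) refl = contradiction ([]=⇒< h≡) (n≮n _)

          go : (∃[ i ] ∃[ p ] d ≡ inj₁ i × h [ index w i ]= (a , p)) → _
          go (i , p , refl , h≡) with m≤n⇒m<n∨m≡n ([]=⇒< h≡)
          ... | inj₁ i< with <⇒[]= h i<
          ...   | σ , h≡′ with position h≡′
          ...     | j , h≡″ , eq-j = left λ none → none (inj₁ j) (eq-j , not-env (inside j h≡″))
          go (i , p , refl , h≡) | inj₂ eq-i = right λ e → implies-intro λ eb none →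
            does-elim y eb λ (b , eq-b , eb) → sub (action-elim eb) eq-b none
            where
            sub : ∀ {b e} → (∃[ j ] ∃[ q ] e ≡ inj₁ j × h [ index w j ]= (b , q)) → op b ≡ incr r →
                  (∀ d → ¬ ⟦ does (decr r) x and (x ∼ y) ⟧ʷ (d , e)) → ⊥
            sub (j , q , refl , h≡′) eq-b none =
              last t h≡ eq-i eq (_ , _ , h≡′ , eq-b) λ m → found (sat-marked (decr r) {inj₁ j} m (process-of h≡′))
              where
              found : _ → ⊥
              found (k , ka , j∼k) = none (inj₁ k) (ka {u = x} refl , sym j∼k)

        sat-correct : ∀ a → ⟦ correctᶠ (op a) a ⟧ʷ (tt , tt)
        sat-correct a = go (op a) refl
          where
          go : ∀ o → op a ≡ o → ⟦ correctᶠ o a ⟧ʷ (tt , tt)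
          go (incr r) eq = subst (λ o → ⟦ onceᶠ o a ⟧ʷ (tt , tt)) eq (sat-once a (λ _ eq′ → contradiction (trans (sym eq) eq′) λ ()))
          go (decr r) eq = subst (λ o → ⟦ onceᶠ o a ⟧ʷ (tt , tt)) eq (sat-once a (λ _ eq′ → contradiction (trans (sym eq) eq′) λ ()))
            , sat-matched a r eq
          go (test r) eq = sat-emptied a r eq

        sat-loading : ∀ m k i {by} {e : Value w by} → index w i ≡ k * 2 → k + m ≡ n → ⟦ loading m ⟧ʷ (inj₁ i , e)
        sat-loading zero k i eq k≡ ia with action-elim ia
        ... | _ , _ , refl , h≡ =
          proj₂ (admissible t h≡) (trans eq (cong (_* 2) (trans (sym (+-identityʳ k)) k≡))) refl
        sat-loading (suc m) k i {e = e} eq k≡ = not-start , succ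
          where
          not-start : ¬ HasAction w (inj₁ (ι start)) (inj₁ i)
          not-start ia with action-elim ia
          ... | _ , _ , refl , h≡ =
            proj₁ (admissible t h≡) k (subst (k <_) k≡ (m<m+n k z<s)) eq refl
          succ : ⟦ ally ((y ≐ x +1) implies allx ((x ≐ y +1) implies loading m)) ⟧ʷ (inj₁ i , e)
          succ (inj₂ _) = implies-intro λ ()
          succ (inj₁ j) = implies-intro λ eq-j → λ
            { (inj₂ _)  → implies-intro λ ()
            ; (inj₁ i′) → implies-intro λ eq-i′ → sat-loading m (suc k) i′
                (trans eq-i′ (cong suc (trans eq-j (cong suc eq)))) (trans (sym (+-suc k m)) k≡)
            }

        sat-loads : ⟦ loadsᶠ n ⟧ʷ (tt , tt)
        sat-loads (inj₂ q) = right (process-loading n)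
          where
          process-loading : ∀ m {by} {e : Value w by} → ⟦ loading m ⟧ʷ (inj₂ q , e)
          process-loading zero    = λ ()
          process-loading (suc m) = (λ ()) , λ { (inj₁ _) → implies-intro λ () ; (inj₂ _) → implies-intro λ () }
        sat-loads (inj₁ i) with index w i in eq
        ... | zero  = right (sat-loading n 0 i eq refl)
        ... | suc k = left λ none → none (inj₁ (proj₁ j)) (trans eq (cong suc (sym (proj₂ j))))
          where j = earlier i (subst (k ≤_) (sym eq) (n≤1+n k))

        sat-padding : ∀ k {bx by} {ρ : Value w bx × Value w by} → ⟦ padding k ⟧ʷ ρ
        sat-padding zero    = λ _ → refl
        sat-padding (suc k) = λ _ → sat-padding k

        satisfied : ℙ-E → (∃[ i ] ∃[ e ] letterAt w i ≡ inj₂ e) ⊎ (∃[ k ] ∃[ p ] h [ k ]= (final , p)) →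
                    w ⊨ lift (game and loadsᶠ n)
        satisfied q end =
          ( sat-padding size
          , (λ none → none (inj₂ (inj₂ q)) (q , refl))
          , sat-starts
          , sat-continues
          , every-intro (λ a → correctᶠ (op a) a) all sat-correct
          , halts end)
          , sat-loads
          where
          halts : _ ⊎ _ → ⟦ haltsᶠ ⟧ʷ (tt , tt)
          halts (inj₁ (i , e , eq)) = left λ none → none (inj₁ i) (env-at eq)
          halts (inj₂ (k , p , h≡)) with position h≡
          ... | i , h≡′ , _ = right λ none → none (inj₁ i) (action-intro h≡′)

    -- What satisfaction forces on a word

    module _ (sat : w ⊨ lift (game and loadsᶠ n)) where

      has-ℙ-E : ¬ ¬ ℙ-E
      has-ℙ-E ¬q = proj₁ (proj₂ (proj₁ sat)) λ d (q , _) → ¬q q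

      first-letter : ∀ i {σ p} → index w i ≡ 0 → letterAt w i ≡ inj₁ (σ , p) →
                     ¬ ¬ (∃[ a ] a ∈ first × σ ≡ ι a)
      first-letter i eq eq-i none = proj₁ (proj₂ (proj₂ (proj₁ sat))) (inj₁ i)
        ( (λ ())
        , λ ¬A → ¬A ((λ ())
        , λ ¬A → ¬A (before
        , λ ¬A → ¬A (not-env eq-i
        , λ t → some-elim (λ a → letter a x) first t λ (a , a∈ , eq-a) →
            none (a , a∈ , inj₁-injective (trans (sym (cong action eq-i)) eq-a))))))
        where
        before : ¬ ¬ (∀ d → ¬ IsSuccessorOf w (inj₁ i) d)
        before ¬none = ¬none λ { (inj₁ j) eq′ → contradiction (trans (sym eq) eq′) 0≢1+n ; (inj₂ _) () }

      next-letter : ∀ j i {σ q} → index w i ≡ suc (index w j) → letterAt w i ≡ inj₁ (σ , q) →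
                    ¬ ¬ (∃[ a ] ∃[ b ] HasAction w (inj₁ (ι a)) (inj₁ j) × b ∈ next a × σ ≡ ι b)
      next-letter j i eq eq-i none =
        implies-elim (proj₁ (proj₂ (proj₂ (proj₂ (proj₁ sat)))) (inj₁ j) (inj₁ i)) eq λ t →
          t (not-env eq-i , λ t → some-elim _ all t λ (a , _ , ja , t) →
            some-elim (λ b → letter b y) (next a) t λ (b , b∈ , eq-b) →
              none (a , b , ja , b∈ , inj₁-injective (trans (sym (cong action eq-i)) eq-b)))

      stays-env : ∀ j i {e} → index w i ≡ suc (index w j) → letterAt w j ≡ inj₂ e →
                  ∃[ e′ ] letterAt w i ≡ inj₂ e′
      stays-env j i eq eq-j with letterAt w i in eq-i
      ... | inj₂ e′ = e′ , refl
      ... | inj₁ _  = ⊥-elim (next-letter j i eq eq-i λ (a , _ , ja , _) →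
        contradiction (trans (sym (cong action eq-j)) ja) λ ())

      module _ {h : List (X × ℙ-S)} (rep : Represents h) where
        open Represents rep

        ends : (∀ i e → letterAt w i ≢ inj₂ e) → ¬ ¬ (∃[ k ] ∃[ p ] h [ k ]= (final , p))
        ends no-env none = proj₂ (proj₂ (proj₂ (proj₂ (proj₂ (proj₁ sat)))))
          ((λ t → t λ { (inj₁ i) eq → environment i eq ; (inj₂ _) () }) ,
           λ t → t λ d eq → found (action-elim rep eq))
          where
          environment : ∀ i → ¬ HasAction w (inj₂ zero) (inj₁ i)
          environment i eq with letterAt w i in eq-i
          ... | inj₂ e = no-env i e eq-i
          environment i () | inj₁ _
          found : ∀ {d} → (∃[ i ] ∃[ p ] d ≡ inj₁ i × h [ index w i ]= (final , p)) → ⊥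
          found (i , p , _ , h≡) = none (_ , p , h≡)

        correct : ∀ a → ⟦ correctᶠ (op a) a ⟧ʷ (tt , tt)
        correct a = every-elim (λ a → correctᶠ (op a) a)
          (proj₁ (proj₂ (proj₂ (proj₂ (proj₂ (proj₁ sat)))))) (∈-all a)

        onceʷ : Once h
        onceʷ {a = a} {b} {p} h≡ h≡′ eq ≢test with position rep h≡ | position rep h≡′
        ... | i , h≡i , refl | j , h≡j , refl = decidable-stable (_ ≟ⁿ _) λ i≢j →
          go (op a) refl (correct a) i≢j
          where
          use : ∀ o → op a ≡ o → ⟦ onceᶠ o a ⟧ʷ (tt , tt) → index w i ≢ index w j → ⊥
          use o eq-o t i≢j = implies-elim (t (inj₁ i) (inj₁ j))
            ( action-intro rep h≡i
            , marked-intro rep y refl h≡j (trans eq eq-o)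
            , trans (process-of rep h≡i) (sym (process-of rep h≡j)))
            λ i≡j → i≢j (cong (index w) (inj₁-injective i≡j))
          go : ∀ o → op a ≡ o → ⟦ correctᶠ o a ⟧ʷ (tt , tt) → index w i ≢ index w j → ⊥
          go (incr r) eq-o t       = use (incr r) eq-o t
          go (decr r) eq-o (t , _) = use (decr r) eq-o t
          go (test r) eq-o _       = contradiction eq-o (≢test r)

        marked-elim : ∀ {bx by o p} (u : Var bx by) {ρ} → ⟦ does o u ⟧ʷ ρ →
          processOf w (value w u ρ) ≡ inj₁ p → ¬ ¬ Marked o p h
        marked-elim u t eq none = does-elim u t λ (a , eq-a , ua) →
          let (i , p , v≡ , h≡) = action-elim rep ua
              p≡ = inj₁-injective (trans (sym (process-of rep h≡)) (trans (cong (processOf w) (sym v≡)) eq))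
          in none (index w i , a , subst (λ p → h [ index w i ]= (a , p)) p≡ h≡ , eq-a)

        matchedʷ : Matched h
        matchedʷ {a = a} {p} {r} h≡ eq none with position rep h≡
        ... | i , h≡i , _ =
          implies-elim (proj₂ (subst (λ o → ⟦ correctᶠ o a ⟧ʷ (tt , tt)) eq (correct a)) (inj₁ i))
            (action-intro rep h≡i) λ some → some λ e (ey , i∼e) →
              marked-elim y {inj₁ i , e} ey (trans (sym i∼e) (process-of rep h≡i)) none

        -- What follows the last letter of `h` can only be Environment's, so the first disjunct of
        -- `emptiedᶠ` fails and the second one must hold.
        emptiedʷ : ∀ {a q h′} → h ≡ (a , q) ∷ h′ → Emptied a h
        emptiedʷ {a} refl {p} {r} eq (k , b , h≡ , eq-b) none
          with position rep (here refl) | position rep h≡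
        ... | i , h≡i , eq-i | j , h≡j , _ =
          implies-elim (subst (λ o → ⟦ correctᶠ o a ⟧ʷ (tt , tt)) eq (correct a) (inj₁ i))
            (action-intro rep h≡i) λ t → t
              ( (λ some → some no-letter)
              , λ t → implies-elim (t (inj₁ j)) (marked-intro rep y {inj₁ i , inj₁ j} refl h≡j eq-b) λ some →
                  some λ e (ex , e∼j) →
                    marked-elim x {e , inj₁ j} ex (trans e∼j (process-of rep h≡j)) none)
          where
          no-letter : ∀ d → ¬ (IsSuccessorOf w d (inj₁ i) × ¬ HasAction w (inj₂ zero) d)
          no-letter (inj₂ _) (() , _)
          no-letter (inj₁ i′) (eq′ , ¬env) = ¬env (env-at (proj₂ (outside i′
            (≤-reflexive (sym (trans eq′ (cong suc eq-i)))))))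

        -- Descends from i to i′ two positions at a time. The positions at which the nested
        -- quantifiers are instantiated exist because none of them lies beyond i′.
        loading-elim : ∀ m i i′ {by} {e : Value w by} → ⟦ loading m ⟧ʷ (inj₁ i , e) →
          (∀ j → j < m → index w i′ ≡ index w i + j * 2 → ¬ HasAction w (inj₁ (ι start)) (inj₁ i′)) ×
          (index w i′ ≡ index w i + m * 2 → ¬ HasAction w (inj₁ (ι load)) (inj₁ i′))
        loading-elim zero i i′ t = (λ _ ()) , same
          where
          same : index w i′ ≡ index w i + 0 → ¬ HasAction w (inj₁ (ι load)) (inj₁ i′)
          same eq with index-injective i′ i (trans eq (+-identityʳ _))
          ... | refl = t
        loading-elim (suc m) i i′ {e = e} (not-start , t) = starting , loadings
          where
          rest : ∀ k → index w i′ ≡ index w i + suc k * 2 → ∃[ i″ ] ∃[ j ]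
            ¬ ¬ ⟦ loading m ⟧ʷ (inj₁ i″ , inj₁ j) × index w i′ ≡ index w i″ + k * 2
          rest k eq = i″ , j , loaded , trans i′≡ (cong (_+ k * 2) (sym (proj₂ after₂)))
            where
            i′≡ : index w i′ ≡ suc (suc (index w i)) + k * 2
            i′≡ = trans eq (trans (+-suc (index w i) (suc (k * 2))) (cong suc (+-suc (index w i) (k * 2))))
            after₂ = earlier i′ {suc (suc (index w i))} (subst (_ ≤_) (sym i′≡) (m≤m+n _ (k * 2)))
            i″ = proj₁ after₂
            after₁ = earlier i″ {suc (index w i)} (subst (_ ≤_) (sym (proj₂ after₂)) (n≤1+n _))
            j = proj₁ after₁
            loaded : ¬ ¬ ⟦ loading m ⟧ʷ (inj₁ i″ , inj₁ j)
            loaded ¬t = implies-elim (t (inj₁ j)) (proj₂ after₁) λ t →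
              implies-elim (t (inj₁ i″)) (trans (proj₂ after₂) (cong suc (sym (proj₂ after₁)))) ¬t

          starting : ∀ j → j < suc m → index w i′ ≡ index w i + j * 2 →
                     ¬ HasAction w (inj₁ (ι start)) (inj₁ i′)
          starting zero _ eq with index-injective i′ i (trans eq (+-identityʳ _))
          ... | refl = not-start
          starting (suc j) (s≤s j<m) eq ia with rest j eq
          ... | i″ , _ , t , eq′ = t λ t → proj₁ (loading-elim m i″ i′ t) j j<m eq′ ia

          loadings : index w i′ ≡ index w i + suc m * 2 → ¬ HasAction w (inj₁ (ι load)) (inj₁ i′)
          loadings eq ia with rest m eq
          ... | i″ , _ , t , eq′ = t λ t → proj₂ (loading-elim m i″ i′ t) eq′ ia

        admissibleʷ : ∀ {k a p} → h [ k ]= (a , p) → Admissible k a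
        admissibleʷ {k} h≡ with position rep h≡
        ... | i , h≡i , refl with earlier i {0} z≤n
        ... | i₀ , eq₀ =
            (λ { j j<n eq refl → initial λ t → proj₁ (loading-elim n i₀ i t) j j<n
                   (trans eq (cong (_+ j * 2) (sym eq₀))) (action-intro rep h≡i) })
          , (λ { eq refl → initial λ t → proj₂ (loading-elim n i₀ i t)
                   (trans eq (cong (_+ n * 2) (sym eq₀))) (action-intro rep h≡i) })
          where
          initial : ¬ ¬ ⟦ loading n ⟧ʷ (inj₁ i₀ , tt)
          initial ¬t = proj₂ sat (inj₁ i₀)
            ( (λ some → some λ { (inj₁ j) eq → contradiction (trans (sym eq₀) eq) 0≢1+n ; (inj₂ _) () })
            , ¬t)

-- Strategies and runs

-- The chronological counterpart of `_[_]=_`: histories list the newest letter first, words and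
-- strategies the oldest.
data At {A : Set} : List A → ℕ → A → Set where
  here  : ∀ {z zs} → At (z ∷ zs) 0 z
  there : ∀ {z z′ zs k} → At zs k z → At (z′ ∷ zs) (suc k) z

module _ {A : Set} where

  At-∷ʳ : ∀ {zs : List A} {k z z′} → At zs k z → At (zs ∷ʳ z′) k z
  At-∷ʳ here       = here
  At-∷ʳ (there at) = there (At-∷ʳ at)

  At-last : ∀ (zs : List A) {z} → At (zs ∷ʳ z) (length zs) z
  At-last []       = here
  At-last (_ ∷ zs) = there (At-last zs)

  At-reverse : ∀ {zs : List A} {k z} → zs [ k ]= z → At (reverse zs) k z
  At-reverse {z ∷ zs} (here refl) =
    subst₂ (λ us k → At us k z) (sym (unfold-reverse z zs)) (length-reverse zs) (At-last (reverse zs))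
  At-reverse {z′ ∷ zs} {k} {z} (there at) =
    subst (λ us → At us k z) (sym (unfold-reverse z′ zs)) (At-∷ʳ (At-reverse at))

  ∷ʳ-view : ∀ (zs : List A) z (i : Fin (length (zs ∷ʳ z))) →
    (∃[ j ] List.lookup (zs ∷ʳ z) i ≡ List.lookup zs j × take (toℕ i) (zs ∷ʳ z) ≡ take (toℕ j) zs × toℕ i ≡ toℕ j)
    ⊎ (List.lookup (zs ∷ʳ z) i ≡ z × take (toℕ i) (zs ∷ʳ z) ≡ zs × toℕ i ≡ length zs)
  ∷ʳ-view []        z zero = inj₂ (refl , refl , refl)
  ∷ʳ-view (z′ ∷ zs) z zero = inj₁ (zero , refl , refl , refl)
  ∷ʳ-view (z′ ∷ zs) z (suc i) with ∷ʳ-view zs z i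
  ... | inj₁ (j , eq , eq′ , eq″) = inj₁ (suc j , eq , cong (z′ ∷_) eq′ , cong suc eq″)
  ... | inj₂ (eq , eq′ , eq″)     = inj₂ (eq , cong (z′ ∷_) eq′ , cong suc eq″)

-- From an accepting run to a winning strategy

module Winner (𝔄 : Automaton) (n s : ℕ) (size≤s : Automaton.size 𝔄 ≤ s) where
  open Automaton 𝔄
  open Formulas 𝔄
  open Runs 𝔄 n

  module _ (𝒫 : Processes) where
    open Processes 𝒫
    open Satisfaction 𝔄 n s size≤s 𝒫
    open Tokens 𝔄 n {ℙ-S}

    -- After a letter of Environment any System letter would violate `continuesᶠ`, so the strategy
    -- falls silent. Otherwise it only counts the letters of the past, which compatibility makes the
    -- planned ones.
    replay : List (X × ℙ-S) → Strategy (alphabet s) 𝒫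
    replay []              _              = nothing
    replay ((a , p) ∷ rs) []             = just (ι a , p)
    replay (_ ∷ rs)       (inj₁ _ ∷ σs) = replay rs σs
    replay (_ ∷ rs)       (inj₂ _ ∷ σs) = nothing

    -- Compatibility leaves a prefix of the plan, then letters of Environment only. If the plan was
    -- cut short, such a letter occurs and satisfies `haltsᶠ`.
    record Follows (rs : List (X × ℙ-S)) (w : DataWord (alphabet s) 𝒫) : Set where
      field
        played rest : List (X × ℙ-S)
        split   : rs ≡ played ++ rest
        inside  : ∀ i {σ} → At played (index w i) σ → letterAt w i ≡ ⌜ σ ⌝
        outside : ∀ i → length played ≤ index w i → ∃[ e ] letterAt w i ≡ inj₂ e
        present : ∀ {k} → k < length played → ∃[ i ] index w i ≡ k
        end     : rest ≡ [] ⊎ (∃[ i ] ∃[ e ] letterAt w i ≡ inj₂ e)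

    follows-finite : ∀ rs σs → Compatible (replay rs) (finite σs) → Follows rs (finite σs)
    follows-finite [] σs (compatible , _) = record
      { played = [] ; rest = [] ; split = refl
      ; inside = λ _ () ; outside = λ i _ → out i ; present = λ () ; end = inj₁ refl }
      where
      out : ∀ i → ∃[ e ] List.lookup σs i ≡ inj₂ e
      out i with List.lookup σs i in eq
      ... | inj₂ e = e , refl
      ... | inj₁ σ = contradiction (compatible i σ eq) λ ()
    follows-finite (ρ ∷ rs) [] (_ , ())
    follows-finite (ρ ∷ rs) (inj₂ e ∷ σs) (compatible , _) = record
      { played = [] ; rest = ρ ∷ rs ; split = refl
      ; inside = λ _ () ; outside = λ i _ → out i ; present = λ () ; end = inj₂ (zero , e , refl) }
      where
      out : ∀ i → ∃[ e′ ] List.lookup (inj₂ e ∷ σs) i ≡ inj₂ e′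
      out zero = e , refl
      out (suc i) with List.lookup σs i in eq
      ... | inj₂ e = e , refl
      ... | inj₁ σ = contradiction (compatible (suc i) σ eq) λ ()
    follows-finite (ρ ∷ rs) (inj₁ τ ∷ σs) (compatible , stops)
      with compatible zero τ refl | follows-finite rs σs ((λ i → compatible (suc i)) , stops)
    ... | refl | fs = record
      { played = ρ ∷ played ; rest = rest ; split = cong (ρ ∷_) split
      ; inside = λ { zero here → refl ; (suc i) (there at) → inside i at }
      ; outside = λ { (suc i) (s≤s ≤i) → outside i ≤i }
      ; present = λ { {zero} _ → zero , refl ; {suc k} (s≤s k<) → map suc (cong suc) (present k<) }
      ; end = [ inj₁ , (λ (i , e , eq) → inj₂ (suc i , e , eq)) ]′ end
      }
      where open Follows fs

    follows-infinite : ∀ rs σ → Compatible (replay rs) (infinite σ) → Follows rs (infinite σ)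
    follows-infinite [] σ (compatible , _) = record
      { played = [] ; rest = [] ; split = refl
      ; inside = λ _ () ; outside = λ i _ → out i ; present = λ () ; end = inj₁ refl }
      where
      out : ∀ i → ∃[ e ] σ i ≡ inj₂ e
      out i with σ i in eq
      ... | inj₂ e = e , refl
      ... | inj₁ τ = contradiction (compatible i τ eq) λ ()
    follows-infinite (ρ ∷ rs) σ (compatible , _) with σ 0 in eq₀
    ... | inj₂ e = record
      { played = [] ; rest = ρ ∷ rs ; split = refl
      ; inside = λ _ () ; outside = λ i _ → out i ; present = λ () ; end = inj₂ (0 , e , eq₀) }
      where
      out : ∀ i → ∃[ e ] σ i ≡ inj₂ e
      out zero = e , eq₀
      out (suc i) with σ (suc i) in eq
      ... | inj₂ e = e , refl
      ... | inj₁ τ = contradiction (trans (sym (compatible (suc i) τ eq)) stopped) λ ()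
        where
        stopped : replay (ρ ∷ rs) (applyUpTo σ (suc i)) ≡ nothing
        stopped rewrite eq₀ = refl
    ... | inj₁ τ with compatible 0 τ eq₀ | follows-infinite rs (σ ∘ suc) (compatible′ , tt)
      where
      continued : ∀ i → replay (ρ ∷ rs) (applyUpTo σ (suc i)) ≡ replay rs (applyUpTo (σ ∘ suc) i)
      continued i rewrite eq₀ = refl
      compatible′ : ∀ i τ → σ (suc i) ≡ inj₁ τ → replay rs (applyUpTo (σ ∘ suc) i) ≡ just τ
      compatible′ i τ eq = trans (sym (continued i)) (compatible (suc i) τ eq)
    ... | refl | fs = record
      { played = ρ ∷ played ; rest = rest ; split = cong (ρ ∷_) split
      ; inside = λ { zero here → eq₀ ; (suc i) (there at) → inside i at }
      ; outside = λ { (suc i) (s≤s ≤i) → outside i ≤i }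
      ; present = λ _ → _ , refl
      -- The plan is finite and the word is not, so Environment moves right after the played part.
      ; end = inj₂ (_ , outside (length played) ≤-refl)
      }
      where open Follows fs

    compatible⇒follows : ∀ rs w → Compatible (replay rs) w → Follows rs w
    compatible⇒follows rs (finite σs)  = follows-finite rs σs
    compatible⇒follows rs (infinite σ) = follows-infinite rs σ

    suffix : ∀ xs {h L} → History (xs ++ h) L → ∃[ L′ ] History h L′
    suffix []       t              = _ , t
    suffix (_ ∷ xs) (step t _ _ _) = suffix xs t

    replay-winning : ∀ {h L p} → History ((final , p) ∷ h) L → ℙ-E →
      Winning (replay (reverse ((final , p) ∷ h))) (lift (game and loadsᶠ n))
    replay-winning {h} {L} {p} t q w compatible _ =
      satisfied w rep (proj₂ (suffix (reverse rest) (subst (λ h → History h L) split′ t))) q end′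
      where
      H = (final , p) ∷ h
      open Follows (compatible⇒follows (reverse H) w compatible)
      split′ : H ≡ reverse rest ++ reverse played
      split′ = trans (sym (reverse-involutive H)) (trans (cong reverse split) (reverse-++ played rest))
      to-At : ∀ {k σ} → reverse played [ k ]= σ → At played k σ
      to-At at = subst (λ us → At us _ _) (reverse-involutive played) (At-reverse at)
      rep : Represents w (reverse played)
      rep = record
        { inside  = λ i at → inside i (to-At at)
        ; outside = λ i → outside i ∘ subst (_≤ index w i) (length-reverse played)
        ; present = present ∘ subst (_ <_) (length-reverse played)
        }
      end′ : (∃[ i ] ∃[ e ] letterAt w i ≡ inj₂ e) ⊎ (∃[ k ] ∃[ p ] reverse played [ k ]= (final , p))
      end′ with end
      ... | inj₂ env = inj₁ env
      ... | inj₁ eq = inj₂ (length h , p , subst (_[ length h ]= (final , p))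
        (trans split′ (cong (λ us → reverse us ++ reverse played) eq)) (here refl))

  winner : ∀ {as v} → Run (final ∷ as) v → PartSynth (alphabet s , relabel _ (game and loadsᶠ n))
  winner {as} r with tokens 𝔄 n (suc (length as)) r ≤-refl
  ... | (a , p) ∷ h , L , t , eq , _ with ∷-injectiveˡ eq
  ... | refl =
    record { ∣ℙ-S∣ = _ ; ∣ℙ-E∣ = 1 } , _ , replay-winning _ t zero

  -- From a winning strategy to runs of every length

  module Extraction (final-idles : ∀ {as v} → Run (final ∷ as) v → Run (final ∷ final ∷ as) v)
                    (next-final : ∀ {b} → b ∈ next final → b ≡ final)
                    (𝒫 : Processes) (𝒮 : Strategy (alphabet s) 𝒫) where
    open Processes 𝒫
    open Satisfaction 𝔄 n s size≤s 𝒫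
    open Tokens 𝔄 n {ℙ-S}

    private
      𝔸 = alphabet s
      φ = lift (game and loadsᶠ n)

    Obeys : List (Letter 𝔸 𝒫) → Set
    Obeys σs = ∀ i τ → List.lookup σs i ≡ inj₁ τ → 𝒮 (take (toℕ i) σs) ≡ just τ

    obeys-∷ʳ : ∀ {σs σ} → Obeys σs → (∀ τ → σ ≡ inj₁ τ → 𝒮 σs ≡ just τ) → Obeys (σs ∷ʳ σ)
    obeys-∷ʳ {σs} {σ} ob last i τ eq with ∷ʳ-view σs σ i
    ... | inj₁ (j , eq₁ , eq₂ , _) = trans (cong 𝒮 eq₂) (ob j τ (trans (sym eq₁) eq))
    ... | inj₂ (eq₁ , eq₂ , _)     = trans (cong 𝒮 eq₂) (last τ (trans (sym eq₁) eq))

    fair-finite : ∀ σs → Fair 𝒮 (finite σs)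
    fair-finite σs often = ⊥-elim (often (length σs) λ i ≤i → contradiction (Fin.toℕ<n i) (≤⇒≯ ≤i))

    module Generated (f : List (Letter 𝔸 𝒫) → Letter 𝔸 𝒫) where

      history : ℕ → List (Letter 𝔸 𝒫)
      history zero    = []
      history (suc k) = history k ∷ʳ f (history k)

      word : ℕ → Letter 𝔸 𝒫
      word k = f (history k)

      applyUpTo-word : ∀ k → applyUpTo word k ≡ history k
      applyUpTo-word zero    = refl
      applyUpTo-word (suc k) =
        trans (sym (applyUpTo-∷ʳ word k)) (cong (_∷ʳ word k) (applyUpTo-word k))

      length-history : ∀ k → length (history k) ≡ k
      length-history zero    = refl
      length-history (suc k) =
        trans (length-++ (history k)) (trans (+-comm _ 1) (cong suc (length-history k)))

      compatible : (∀ k τ → word k ≡ inj₁ τ → 𝒮 (history k) ≡ just τ) → Compatible 𝒮 (infinite word)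
      compatible ob = (λ k τ eq → trans (cong 𝒮 (applyUpTo-word k)) (ob k τ eq)) , tt

      fair : ∀ m → (∀ k → m ≤ k → 𝒮 (history k) ≢ nothing → ∃[ σ ] word k ≡ inj₁ σ) →
             Fair 𝒮 (infinite word)
      fair m serves often l none = often (m ⊔ l) λ k ≤k wants →
        none k (≤-trans (m≤n⊔m m l) ≤k)
          (serves k (≤-trans (m≤m⊔n m l) ≤k) (wants ∘ trans (cong 𝒮 (applyUpTo-word k))))

    obey : Letter 𝔸 𝒫 → Maybe (Σ-S 𝔸 𝒫) → Letter 𝔸 𝒫
    obey σ (just τ) = inj₁ τ
    obey σ nothing  = σ

    obey-serves : ∀ {σ m} → m ≢ nothing → ∃[ τ ] obey σ m ≡ inj₁ τ
    obey-serves {m = just τ}  _  = τ , refl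
    obey-serves {m = nothing} ≢n = contradiction refl ≢n

    obey-obeys : ∀ {σ m τ} → (∀ τ → σ ≡ inj₁ τ → m ≢ nothing) → obey σ m ≡ inj₁ τ → m ≡ just τ
    obey-obeys {m = just _}  _ refl = refl
    obey-obeys {m = nothing} d eq   = contradiction refl (d _ eq)

    module _ (win : Winning 𝒮 φ) where

      -- Without Environment processes 𝒮 is followed forever or until it stops.
      environment : ¬ ¬ ℙ-E
      environment ¬q with 𝒮 [] in eq₀
      ... | nothing = has-ℙ-E (finite []) (win (finite []) ((λ ()) , eq₀) (fair-finite [])) ¬q
      ... | just σ₀ = has-ℙ-E (infinite word) (win (infinite word)
          (compatible λ k τ → obey-obeys (λ _ _ → never k))
          (fair 0 λ k _ → obey-serves)) ¬q
        where
        -- In the absence of Environment processes the default must be a System letter, and the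
        -- first move of the strategy supplies one. It is never played: were the strategy to stop,
        -- the finite word so far would already demand an Environment process.
        open Generated (λ σs → obey (inj₁ σ₀) (𝒮 σs))
        obeys : ∀ k → Obeys (history k)
        never : ∀ k → 𝒮 (history k) ≢ nothing
        obeys zero    = λ ()
        obeys (suc k) = obeys-∷ʳ (obeys k) λ τ → obey-obeys (λ _ _ → never k)
        never k eq = has-ℙ-E (finite (history k))
          (win (finite (history k)) (obeys k , eq) (fair-finite (history k))) ¬q

      spell : List (X × ℙ-S) → List (Letter 𝔸 𝒫)
      spell []      = []
      spell (σ ∷ h) = spell h ∷ʳ ⌜ σ ⌝

      length-spell : ∀ h → length (spell h) ≡ length h
      length-spell []      = refl
      length-spell (σ ∷ h) = trans (length-++ (spell h)) (trans (+-comm _ 1) (cong suc (length-spell h)))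

      data Plays : List (X × ℙ-S) → Set where
        []  : Plays []
        _∷_ : ∀ {h a p} → 𝒮 (spell h) ≡ just (ι a , p) → Plays h → Plays ((a , p) ∷ h)

      plays-obeys : ∀ {h} → Plays h → Obeys (spell h)
      plays-obeys []       = λ ()
      plays-obeys (eq ∷ pl) = obeys-∷ʳ (plays-obeys pl) λ { τ refl → eq }

      spell-represents : ∀ h → Represents (finite (spell h)) h
      spell-represents h = record
        { inside  = spelled h
        ; outside = λ i ≤i → contradiction (subst (toℕ i <_) (length-spell h) (Fin.toℕ<n i)) (≤⇒≯ ≤i)
        ; present = λ k< → _ , Fin.toℕ-fromℕ< (subst (_ <_) (sym (length-spell h)) k<)
        }
        where
        spelled : ∀ h i {σ} → h [ toℕ i ]= σ → List.lookup (spell h) i ≡ ⌜ σ ⌝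
        spelled (τ ∷ h) i at with ∷ʳ-view (spell h) ⌜ τ ⌝ i | at
        ... | inj₁ (j , eq , _ , eq′) | here eq″ =
          contradiction (Fin.toℕ<n j) (<-irrefl (trans (sym eq′) (trans eq″ (sym (length-spell h)))))
        ... | inj₁ (j , eq , _ , eq′) | there at = trans eq (spelled h j (subst (h [_]= _) eq′ at))
        ... | inj₂ (eq , _ , eq′)     | here _   = eq
        ... | inj₂ (eq , _ , eq′)     | there at =
          contradiction ([]=⇒< at) (<-irrefl (trans eq′ (length-spell h)))

      -- Interrupting 𝒮 makes a test the last letter of System, so that it is checked.
      module Interrupted (q : ℙ-E) (T : ℕ) where

        choose : List (Letter 𝔸 𝒫) → Letter 𝔸 𝒫
        choose σs with length σs ≟ⁿ T
        ... | yes _ = inj₂ (zero , q)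
        ... | no _  = obey (inj₂ (zero , q)) (𝒮 σs)

        open Generated choose public

        choose-obeys : ∀ σs τ → choose σs ≡ inj₁ τ → 𝒮 σs ≡ just τ
        choose-obeys σs τ eq with length σs ≟ⁿ T
        choose-obeys σs τ () | yes _
        choose-obeys σs τ eq | no _  = obey-obeys (λ _ ()) eq

        choose-serves : ∀ σs → length σs ≢ T → 𝒮 σs ≢ nothing → ∃[ τ ] choose σs ≡ inj₁ τ
        choose-serves σs ≢T wants with length σs ≟ⁿ T
        ... | yes eq = contradiction eq ≢T
        ... | no _   = obey-serves wants

        choose-just : ∀ {σs τ} → length σs ≢ T → 𝒮 σs ≡ just τ → choose σs ≡ inj₁ τ
        choose-just {σs} ≢T eq with length σs ≟ⁿ T
        ... | yes eq′ = contradiction eq′ ≢T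
        ... | no _    = cong (obey _) eq

        choose-interrupts : ∀ σs → length σs ≡ T → choose σs ≡ inj₂ (zero , q)
        choose-interrupts σs eq with length σs ≟ⁿ T
        ... | yes _  = refl
        ... | no ≢T  = contradiction eq ≢T

        satisfied-word : infinite word ⊨ φ
        satisfied-word = win (infinite word) (compatible (λ k → choose-obeys (history k)))
          -- The strategy is denied its move only at time T, so fairness can be read off from T + 1
          -- on.
          (fair (suc T) λ k T<k → choose-serves (history k)
            (λ eq → <-irrefl (trans (sym eq) (length-history k)) T<k))

        history-spell : ∀ {h} → Plays h → length h ≤ T → history (length h) ≡ spell h
        word-spell : ∀ {h τ} → Plays h → length h < T → 𝒮 (spell h) ≡ just τ → word (length h) ≡ inj₁ τ
        history-spell []        _   = refl
        history-spell (eq ∷ pl) h< =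
          cong₂ _∷ʳ_ (history-spell pl (<⇒≤ h<)) (word-spell pl h< eq)
        word-spell {h} pl h<T eq = choose-just
          (λ eq′ → <-irrefl (trans (sym (length-history (length h))) eq′) h<T)
          (trans (cong 𝒮 (history-spell pl (<⇒≤ h<T))) eq)

        word-inside : ∀ {h} → Plays h → length h ≤ T → ∀ {k σ} → h [ k ]= σ → word k ≡ ⌜ σ ⌝
        word-inside (eq ∷ pl) h≤ (here refl) = word-spell pl h≤ eq
        word-inside (eq ∷ pl) h≤ (there at)  = word-inside pl (<⇒≤ h≤) at

        -- The strategy is granted its wishes again after T, but it is winning: resuming play would
        -- falsify the formula.
        word-outside : ∀ i → T ≤ i → ∃[ e ] word i ≡ inj₂ e
        word-outside i T≤i with m≤n⇒m<n∨m≡n T≤i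
        ... | inj₂ refl = _ , choose-interrupts (history i) (length-history i)
        word-outside (suc i) _ | inj₁ (s≤s T≤i) =
          stays-env (infinite word) satisfied-word i (suc i) refl (proj₂ (word-outside i T≤i))

        word-represents : ∀ {h} → Plays h → length h ≡ T → Represents (infinite word) h
        word-represents pl refl = record
          { inside  = λ _ → word-inside pl ≤-refl
          ; outside = word-outside
          ; present = λ _ → _ , refl
          }

      module _ (q : ℙ-E) where

        next-option : ∀ {h σ p} → Plays h → 𝒮 (spell h) ≡ just (σ , p) →
                      ¬ ¬ (∃[ a ] a ∈ options (List.map proj₁ h) × σ ≡ ι a)
        next-option {h} pl eq none with Interrupted.word-spell q (suc (length h)) pl ≤-refl eq
        next-option {[]} pl eq none | eq-w = first-letter (infinite word) satisfied-word 0 refl eq-w none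
          where open Interrupted q 1
        next-option {(a , p) ∷ h} pl eq none | eq-w =
          next-letter (infinite word) satisfied-word (length h) (suc (length h)) refl eq-w
            λ (a′ , b , eq-a , b∈ , eq-b) → none (b , subst (λ a → b ∈ next a) (same eq-a) b∈ , eq-b)
          where
          open Interrupted q (2 + length h)
          same : ∀ {a′} → action (word (length h)) ≡ inj₁ (ι a′) → a′ ≡ a
          same eq-a = ι-injective (inj₁-injective
            (trans (sym eq-a) (cong action (word-inside pl (n≤1+n _) (here refl)))))

        extend-play : ∀ {h L a p} → Plays ((a , p) ∷ h) → History h L → a ∈ options (List.map proj₁ h) →
                      ¬ ¬ (∃[ L′ ] History ((a , p) ∷ h) L′)
        extend-play {h} {a = a} pl t a∈ none =
          extend t (onceʷ (infinite word) satisfied-word rep) (matchedʷ (infinite word) satisfied-word rep)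
            (emptiedʷ (infinite word) satisfied-word rep refl) (op a) refl
            λ (L′ , mv) → none (L′ , step t a∈ (admissibleʷ (infinite word) satisfied-word rep (here refl)) mv)
          where
          open Interrupted q (suc (length h))
          rep = word-represents pl refl

        final-last : ∀ {h L k p} → History h L → h [ k ]= (final , p) →
                     ∃[ h′ ] ∃[ p′ ] h ≡ (final , p′) ∷ h′
        final-last (step _ _ _ _) (here _) = _ , _ , refl
        final-last (step t a∈ _ _) (there at) with final-last t at
        ... | _ , _ , refl with next-final a∈
        ... | refl = _ , _ , refl

        -- Either the strategy is still playing at time T, or it has stopped after an accepting run,
        -- which is prolonged by idling.
        Long : ℕ → Set
        Long T = (∃[ h ] ∃[ L ] History h L × Plays h × length h ≡ T)
               ⊎ (∃[ as ] ∃[ v ] Run (final ∷ as) v × length (final ∷ as) ≡ T)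

        -- If the strategy moves, interrupting it after the new letter shows the move legal. If it
        -- stops, the finite word has no letter of Environment, so `haltsᶠ` yields a final letter,
        -- which only final letters can follow.
        prolong : ∀ {h L} → History h L → Plays h → ∀ m → 𝒮 (spell h) ≡ m → ¬ ¬ Long (suc (length h))
        prolong t pl (just (σ , p)) eq none = next-option pl eq λ
          { (a , a∈ , refl) → extend-play (eq ∷ pl) t a∈ λ (L′ , t′) →
              none (inj₁ (_ , L′ , t′ , eq ∷ pl , refl)) }
        prolong {h} t pl nothing eq none =
          ends w (win w (plays-obeys pl , eq) (fair-finite (spell h))) rep no-env λ (k , p , at) → go (final-last t at)
          where
          w = finite (spell h)
          rep = spell-represents h
          no-env : ∀ i e → letterAt w i ≢ inj₂ e
          no-env i e eq with <⇒[]= h (subst (toℕ i <_) (length-spell h) (Fin.toℕ<n i))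
          ... | _ , at = contradiction (trans (sym eq) (Represents.inside rep i at)) λ ()
          go : (∃[ h′ ] ∃[ p′ ] h ≡ (final , p′) ∷ h′) → ⊥
          go (h′ , p′ , refl) = none (inj₂ (_ , _ , final-idles (counters t) , cong (2 +_) (length-map proj₁ h′)))

        long : ∀ T → ¬ ¬ Long T
        long zero    none = none (inj₁ ([] , _ , [] , [] , refl))
        long (suc T) none = long T λ
          { (inj₁ (h , L , t , pl , refl)) → prolong t pl (𝒮 (spell h)) refl none
          ; (inj₂ (as , v , r , refl))     → none (inj₂ (_ , v , final-idles r , refl))
          }

      run-of-length : ∀ T → ¬ ¬ (∃[ as ] ∃[ v ] Run as v × length as ≡ T)
      run-of-length T none = environment λ q → long q T λ
        { (inj₁ (h , L , t , _ , eq)) → none (_ , _ , counters t , trans (length-map proj₁ h) eq)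
        ; (inj₂ (as , v , r , eq))    → none (_ , v , r , eq)
        }

-- Diagonalisation

module Coding (_⊗_ : ℕ → ℕ → ℕ) where
  open Nesting _⊗_

  codeᵍ : ∀ {𝔸 bx by} → FO² 𝔸 bx by → ℕ
  codeᵍ (act (inj₁ a) u) = 0 ⊗ (toℕ a ⊗ codeVar u)
  codeᵍ (act (inj₂ a) u) = 1 ⊗ (toℕ a ⊗ codeVar u)
  codeᵍ (u ≐ v)          = 2 ⊗ (codeVar u ⊗ codeVar v)
  codeᵍ (u ≐ v +1)       = 3 ⊗ (codeVar u ⊗ codeVar v)
  codeᵍ (u ∼ v)          = 4 ⊗ (codeVar u ⊗ codeVar v)
  codeᵍ (isS u)          = 5 ⊗ codeVar u
  codeᵍ (isE u)          = 6 ⊗ codeVar u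
  codeᵍ (isSE u)         = 7 ⊗ codeVar u
  codeᵍ (neg φ)          = 8 ⊗ codeᵍ φ
  codeᵍ (φ and ψ)        = 9 ⊗ (codeᵍ φ ⊗ codeᵍ ψ)
  codeᵍ (φ or ψ)         = 10 ⊗ (codeᵍ φ ⊗ codeᵍ ψ)
  codeᵍ (existsx φ)      = 11 ⊗ codeᵍ φ
  codeᵍ (existsy φ)      = 12 ⊗ codeᵍ φ
  codeᵍ (allx φ)         = 13 ⊗ codeᵍ φ
  codeᵍ (ally φ)         = 14 ⊗ codeᵍ φ

  -- The code of `loading zero`: negation has tag 8, a System action tag 0, `load` is letter number
  -- 1, and `x` is variable 0.
  x₀ : ℕ
  x₀ = 8 ⊗ (0 ⊗ (1 ⊗ 0))

  -- `ks` is one level of `loading` read from the outside: conjunction with the negated `start`,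
  -- `ally`, an implication from y = x + 1, `allx`, an implication from x = y + 1, each implication
  -- being a disjunction with a negated left side. `ls` is the context of the chain in `loadsᶠ`.
  ks ls : List ℕ
  ks = 9 ∷ (8 ⊗ (0 ⊗ (0 ⊗ 0))) ∷ 14 ∷ 10 ∷ (8 ⊗ (3 ⊗ (1 ⊗ 0)))
     ∷ 13 ∷ 10 ∷ (8 ⊗ (3 ⊗ (0 ⊗ 1))) ∷ []
  ls = 13 ∷ 10 ∷ (12 ⊗ (3 ⊗ (0 ⊗ 1))) ∷ []

  module _ {m : ℕ} (P : Prog (Registers {m})) where
    open Control P
    open Formulas control

    loading-code : ∀ {by} n → codeᵍ (loading {by} n) ≡ wraps ks n x₀
    loading-code zero    = refl
    loading-code (suc n) = cong (wrap ks) (loading-code n)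

    instance-code : (f : ∀ {s} → Sentence (alphabet s) → ℕ) → (∀ {s} (φ : Sentence (alphabet s)) → f φ ≡ codeᵍ φ) →
      ∀ n → f game ≡ n → n ⊗ (1 ⊗ f (game and loadsᶠ n)) ≡ target x₀ ks ls n
    instance-code f f≡ n eq rewrite f≡ (game and loadsᶠ n) =
      cong₂ (λ i j → n ⊗ wrap (1 ∷ 9 ∷ []) (i ⊗ wrap ls j)) (trans (sym (f≡ game)) eq) (loading-code n)

open Nesting ⟨_,_⟩ using (target)
open Coding ⟨_,_⟩ using (codeᵍ; x₀; ks; ls; instance-code)

codeᵍ≡code : ∀ {𝔸 bx by} (φ : FO² 𝔸 bx by) → codeᵍ φ ≡ codeFO² φ
codeᵍ≡code (act (inj₁ a) u) = refl
codeᵍ≡code (act (inj₂ a) u) = refl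
codeᵍ≡code (u ≐ v)          = refl
codeᵍ≡code (u ≐ v +1)       = refl
codeᵍ≡code (u ∼ v)          = refl
codeᵍ≡code (isS u)          = refl
codeᵍ≡code (isE u)          = refl
codeᵍ≡code (isSE u)         = refl
codeᵍ≡code (neg φ)          = cong ⟨ 8 ,_⟩ (codeᵍ≡code φ)
codeᵍ≡code (φ and ψ)        = cong₂ (λ i j → ⟨ 9 , ⟨ i , j ⟩ ⟩) (codeᵍ≡code φ) (codeᵍ≡code ψ)
codeᵍ≡code (φ or ψ)         = cong₂ (λ i j → ⟨ 10 , ⟨ i , j ⟩ ⟩) (codeᵍ≡code φ) (codeᵍ≡code ψ)
codeᵍ≡code (existsx φ)      = cong ⟨ 11 ,_⟩ (codeᵍ≡code φ)
codeᵍ≡code (existsy φ)      = cong ⟨ 12 ,_⟩ (codeᵍ≡code φ)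
codeᵍ≡code (allx φ)         = cong ⟨ 13 ,_⟩ (codeᵍ≡code φ)
codeᵍ≡code (ally φ)         = cong ⟨ 14 ,_⟩ (codeᵍ≡code φ)

code-relabelled : ∀ {s} s′ (f : Fin s → Fin s′) → (∀ i → toℕ (f i) ≡ toℕ i) →
  (φ : Sentence (alphabet s)) {i : Instance} → i ≡ (alphabet s′ , relabel f φ) →
  code i ≡ ⟨ s′ , ⟨ 1 , sentenceCode φ ⟩ ⟩
code-relabelled s′ f eq φ refl =
  cong (λ i → ⟨ s′ , ⟨ 1 , i ⟩ ⟩) (trans (code-relabel f eq φ) (sym (sentenceCode≡codeFO² φ)))

module Diagonal
  (M : Machine) (P : Prog (Registers {Machine.r-1 M})) (goal : ℕ → ℕ)
  (code-instance : ∀ n → sentenceCode (Formulas.game (Control.control P)) ≡ n →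
     ⟨ n , ⟨ 1 , sentenceCode (Formulas.game (Control.control P) and Formulas.loadsᶠ (Control.control P) n) ⟩ ⟩
       ≡ goal n)
  (runs : ∀ n {b} → Answers M (Machine.initial M (goal n)) b →
          ∃[ w ] P ⊢ Control.loaded P n ⇓ w × Vec.lookup w F ≡ Simulation.flag M b)
  (c : ℕ) (code≡c : sentenceCode (Formulas.game (Control.control P)) ≡ c) where

  open Control P
  open Formulas control

  size≤c : Automaton.size control ≤ c
  size≤c = subst (Automaton.size control ≤_) code≡c (size≤code control)

  diagonal : Instance
  diagonal = alphabet c , relabel (λ i → inject≤ i size≤c) (game and loadsᶠ c)

  code-diagonal : code diagonal ≡ goal c
  code-diagonal = trans
    (code-relabelled c (λ i → inject≤ i size≤c) (λ i → toℕ-inject≤ i size≤c) (game and loadsᶠ c) {diagonal} refl)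
    (code-instance c code≡c)

  open Runs control c
  open Winner control c c size≤c

  final-idles : ∀ {as v} → Run (halt-letter ∷ as) v → Run (halt-letter ∷ halt-letter ∷ as) v
  final-idles r@(step _ _ _ (v≡0 , refl)) =
    step r (here refl) ((λ _ _ _ ()) , λ _ ()) (v≡0 , refl)

  unsolvable : ∀ {k} → (∀ {h v} → Run h v → List.length h ≢ k) → ¬ PartSynth diagonal
  unsolvable {k} none (𝒫 , 𝒮 , win) =
    Extraction.run-of-length final-idles (λ { (here refl) → refl }) 𝒫 𝒮 win k
      λ (as , v , r , eq) → none r eq

  -- A positive answer leaves `F` at one and thereby excludes a winning strategy; a negative answer
  -- leaves it at zero, and the accepting run provides one.
  incorrect′ : ∀ {b w} → P ⊢ loaded c ⇓ w → Vec.lookup w F ≡ Simulation.flag M b →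
               ¬ Reflects (PartSynth diagonal) b
  incorrect′ d eq (ofʸ synth)  =
    unsolvable (proj₂ (rejecting c d λ eq′ → 1+n≢0 (trans (sym eq) eq′))) synth
  incorrect′ d eq (ofⁿ ¬synth) = ¬synth (winner (proj₂ (proj₂ (accepting c d eq))))

  incorrect : ∀ {b} → Answers M (Machine.initial M (code diagonal)) b → ¬ Reflects (PartSynth diagonal) b
  incorrect {b} answers = incorrect′ (proj₁ (proj₂ run)) (proj₂ (proj₂ run))
    where
    run = runs c (subst (λ i → Answers M (Machine.initial M i) b) code-diagonal answers)

sentenceCode≡codeᵍ : ∀ {s} (φ : Sentence (alphabet s)) → sentenceCode φ ≡ codeᵍ φ
sentenceCode≡codeᵍ φ = trans (sentenceCode≡codeFO² φ) (sym (codeᵍ≡code φ))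

theorem4 : ¬ (∃[ M ] M Decides PartSynth)
theorem4 (M , decides) = incorrect (proj₁ (proj₂ (decides diagonal))) (proj₂ (proj₂ (decides diagonal)))
  where
  P = Simulation.main M x₀ ks ls
  open Diagonal M P (target x₀ ks ls) (instance-code P sentenceCode sentenceCode≡codeᵍ)
    (Simulation.main-⇓ M x₀ ks ls) (sentenceCode (Formulas.game (Control.control P))) refl
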